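{- Let $q$ be a prime power and $\mathbb{F}_q$ the finite field with $q$ elements. If $q=2$ or $q=3$, then there are infinitely many pairs $(F,G)$ of nonzero monic polynomials in $\mathbb{F}_q[T]$ with $\varphi(F)=\sigma(G)$. If $q\neq 2,3$, then the only pair $(F,G)$ of nonzero monic polynomials in $\mathbb{F}_q[T]$ with $\varphi(F)=\sigma(G)$ is $F=G=1$.
   Context: For a nonzero $A\in\mathbb{F}_q[T]$ let $|A|=q^{\deg A}$. A "prime" means a monic irreducible polynomial, and $v_P(F)$ is the exponent of the prime $P$ in $F$. For nonzero $F\in\mathbb{F}_q[T]$, $\varphi(F)=\#(\mathbb{F}_q[T]/(F))^*=\prod_{P\mid F}|P|^{v_P(F)-1}(|P|-1)$, the product over primes $P$ dividing $F$, and $\sigma(G)=\sum_{D\mid G}|D|$, the sum over monic divisors $D$ of $G$. -}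

module Defs where

open import Level using (0ℓ)
open import Data.Nat using (ℕ; zero; suc; _^_; _∸_; _⊔_) renaming (_+_ to _+ℕ_; _*_ to _*ℕ_)
open import Data.Bool using (Bool; true; false; if_then_else_; _∧_; _∨_; not)
open import Data.Fin using (Fin)
open import Data.Vec using (Vec; []; _∷_; toList)
open import Data.List using (List; []; _∷_; [_]; _++_; map; concatMap; upTo; allFin; foldr)
open import Data.Bool.ListAction using (any; all)
open import Data.Nat.ListAction using (sum; product)
import Data.List.Properties as LP
open import Data.Product using (Σ; _,_; proj₁)
open import Relation.Binary.PropositionalEquality using (_≡_; _≢_)
open import Relation.Binary.Definitions using (DecidableEquality)
open import Relation.Nullary.Decidable using (⌊_⌋)
open import Algebra.Structures using (IsCommutativeRing)
open import Function.Bundles using (_↔_; Inverse)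

record FiniteField (q : ℕ) : Set₁ where
  field
    Carrier : Set
    _+_ _*_ : Carrier → Carrier → Carrier
    -_      : Carrier → Carrier
    0# 1#   : Carrier
    isCommutativeRing : IsCommutativeRing _≡_ _+_ _*_ -_ 0# 1#
    0≢1     : 0# ≢ 1#
    inverse : ∀ x → x ≢ 0# → Σ Carrier (λ y → x * y ≡ 1#)
    _≟_     : DecidableEquality Carrier
    enum    : Fin q ↔ Carrier

module FF {q : ℕ} (𝔽 : FiniteField q) where
  open FiniteField 𝔽

  -- Polynomials as coefficient lists, lowest degree first (not normalised).
  Poly : Set
  Poly = List Carrier

  padd : Poly → Poly → Poly
  padd []       g        = g
  padd (a ∷ f)  []       = a ∷ f
  padd (a ∷ f)  (b ∷ g)  = (a + b) ∷ padd f g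

  pmul : Poly → Poly → Poly
  pmul []      g = []
  pmul (a ∷ f) g = padd (map (a *_) g) (0# ∷ pmul f g)

  ppow : Poly → ℕ → Poly
  ppow f zero    = [ 1# ]
  ppow f (suc k) = pmul f (ppow f k)

  -- A monic polynomial of degree n: its n lower coefficients (leading coeff 1 implicit).
  -- This representation is canonical, so ≡ on Monic is equality of polynomials.
  Monic : Set
  Monic = Σ ℕ (Vec Carrier)

  deg : Monic → ℕ
  deg = proj₁

  coeffs : Monic → Poly
  coeffs (n , v) = toList v ++ [ 1# ]

  one : Monic
  one = (0 , [])

  ∣_∣ : Monic → ℕ
  ∣ A ∣ = q ^ deg A

  elems : List Carrier
  elems = map (Inverse.to enum) (allFin q)

  vecs : (n : ℕ) → List (Vec Carrier n)
  vecs zero    = [ [] ]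
  vecs (suc n) = concatMap (λ a → map (a ∷_) (vecs n)) elems

  monicsOfDeg : ℕ → List Monic
  monicsOfDeg n = map (n ,_) (vecs n)

  monicsUpTo : ℕ → List Monic
  monicsUpTo n = concatMap monicsOfDeg (upTo (suc n))

  _≟P_ : DecidableEquality Poly
  _≟P_ = LP.≡-dec _≟_

  -- f divides the monic G:  f · E = G for some monic E (necessarily deg E ≤ deg G)
  dividesᵇ : Poly → Monic → Bool
  dividesᵇ f G = any (λ E → ⌊ pmul f (coeffs E) ≟P coeffs G ⌋) (monicsUpTo (deg G))

  -- prime = monic irreducible: degree ≥ 1 and every monic divisor has degree 0 (is 1) or deg P (is P)
  isPrimeᵇ : Monic → Bool
  isPrimeᵇ P = not ⌊ deg P Data.Nat.≟ 0 ⌋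
             ∧ all (λ D → not (dividesᵇ (coeffs D) P)
                          ∨ ⌊ deg D Data.Nat.≟ 0 ⌋ ∨ ⌊ deg D Data.Nat.≟ deg P ⌋)
                   (monicsUpTo (deg P))

  v : Monic → Monic → ℕ
  v P F = foldr (λ k acc → if dividesᵇ (ppow (coeffs P) k) F then k ⊔ acc else acc)
                0 (upTo (suc (deg F)))

  φ : Monic → ℕ
  φ F = product (map (λ P → if isPrimeᵇ P ∧ dividesᵇ (coeffs P) F
                              then ∣ P ∣ ^ (v P F ∸ 1) *ℕ (∣ P ∣ ∸ 1)
                              else 1)
                     (monicsUpTo (deg F)))

  σ : Monic → ℕ
  σ G = sum (map (λ D → if dividesᵇ (coeffs D) G then ∣ D ∣ else 0)
                 (monicsUpTo (deg G)))

{-# OPTIONS --safe #-}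
module Submission where

-- For q = 2 and a prime P of degree n, φ(P) = 2ⁿ - 1 = σ(Tⁿ⁻¹); for q = 3 and n > 1,
-- φ(T P) = 2 (3ⁿ - 1) = σ(Tⁿ⁻¹ (T + 1)). There are primes P of arbitrarily large degree.
--
-- For q > 3, φ(F) = σ(G) ≡ 1 (mod q) forces F to be squarefree. Writing d for the degrees of the
-- primes of F and e, m - 1 for the degrees and exponents of the primes of G, the equation becomes
-- ∏ (q^d - 1) ∏ (q^e - 1) = ∏ (q^(e m) - 1). Equal products of numbers q^n - 1 have equally many
-- factors, so F has no prime divisor. Indeed, suppose the numbers of exponents n divisible by N
-- differ on the two sides (initially N = 1), and let p be a prime modulo which q has order N.
-- Comparing exponents of p, they also differ for some N p^j with j > 0, and by a Zsigmondy-type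
-- argument q has order N p^j modulo some prime. Iterating, N grows beyond every exponent n.

open import Defs
open import Algebra.Bundles using (CommutativeRing)
import Algebra.Properties.CommutativeSemigroup as CommutativeSemigroupProperties
open import Data.Bool using (Bool; true; false; if_then_else_)
open import Data.Bool.ListAction using (any; all)
open import Data.Empty using (⊥-elim)
open import Data.Fin as Fin using (Fin; toℕ; fromℕ<)
open import Data.Fin.Properties using (pigeonhole; toℕ<n; toℕ-fromℕ<)
open import Data.List using (List; []; _∷_; [_]; _++_; map; length; filter; concatMap; upTo; cartesianProductWith; foldr)
open import Data.List.Membership.Propositional using (_∈_; _∉_; find; lose)
open import Data.List.Membership.Propositional.Properties using (∈-map⁺; ∈-map⁻; ∈-upTo⁺; ∈-concatMap⁺; ∈-allFin; ∈-filter⁺; ∈-filter⁻; ∈-++⁺ˡ; ∈-++⁺ʳ; ∈-++⁻; ∈-cartesianProductWith⁺)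
open import Data.List.Membership.Propositional.Properties.WithK using (unique∧set⇒bag)
open import Data.List.Properties using (map-++; length-map; length-++)
open import Data.List.Relation.Binary.BagAndSetEquality using (∼bag⇒↭)
open import Data.List.Relation.Binary.Permutation.Propositional using (_↭_)
import Data.List.Relation.Binary.Permutation.Propositional.Properties as Perm
open import Data.List.Relation.Unary.All as All using (All; []; _∷_)
import Data.List.Relation.Unary.All.Properties as AllP
open import Data.List.Relation.Unary.AllPairs as AllPairs using (AllPairs)
import Data.List.Relation.Unary.AllPairs.Properties as AllPairsP
open import Data.List.Relation.Unary.Any as Any using (Any; here; there)
import Data.List.Relation.Unary.Any.Properties as AnyP
open import Data.List.Relation.Unary.Unique.Propositional using (Unique)
import Data.List.Relation.Unary.Unique.Propositional.Properties as UniqueP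
open import Data.Nat
open import Data.Nat.Divisibility
open import Data.Nat.DivMod using (m≡m%n+[m/n]*n; m%n<n)
open import Data.Nat.Induction using (<-rec)
open import Data.Nat.ListAction using (sum; product)
open import Data.Nat.ListAction.Properties using (sum-++; sum-↭; product-++; product-↭; ∈⇒∣product)
open import Data.Nat.Primality
open import Data.Nat.Primality.Factorisation using (factorise)
open import Data.Nat.Properties
open import Data.Nat.Tactic.RingSolver using (solve-∀)
open import Data.Product using (Σ; ∃; ∃₂; _×_; _,_; proj₁; proj₂; uncurry)
open import Data.Sum using (_⊎_; inj₁; inj₂)
open import Data.Vec using (Vec; []; _∷_; toList)
open import Data.Vec.Properties using (length-toList)
open import Function using (_∘_; Inverse; mk⇔)
open import Relation.Binary.Bundles using (Setoid)
open import Relation.Binary.Definitions using (tri<; tri≈; tri>)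
open import Relation.Binary.PropositionalEquality hiding ([_])
open import Relation.Binary.Structures using (IsEquivalence)
open import Relation.Nullary
open import Relation.Nullary.Decidable using (⌊_⌋; _×-dec_; ¬?)
open import Relation.Nullary.Reflects using (_×-reflects_; _⊎-reflects_; ¬-reflects)

-- Products of numbers qⁿ - 1

-- Counting factors is where q = 2 and q = 3 drop out: 2 - 1 is an empty product, and (3 - 1)³ = 3²
-- - 1. If r = q - 1 is at least 3, then r has an odd prime divisor or is divisible by 4. This gives
-- the first prime p, with N = 1; when p = 2, the condition 4 ∣ r takes the place of oddness in
-- lifting the exponent.
--
-- The general theorem of Zsigmondy rests on cyclotomic polynomials; here a cruder size bound is
-- enough. Comparing with the quotients for all maximal proper divisors N/ℓ succeeds only if the sum
-- of the 1/ℓ is below 1, which fails for N = 30. But each N that occurs is built one prime at a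
-- time, and q has order N modulo the prime that is added next, so this prime exceeds N. The prime
-- divisors of N therefore grow fast enough to keep the sum below 1. The same inequality makes every
-- prime after the first one odd.

geo : ℕ → ℕ → ℕ
geo x zero    = 0
-- `geo x n` is 1 + x + ⋯ + x^(n-1) in Horner form, the recursion that σ obeys along the powers of a
-- prime of norm `x`.
geo x (suc n) = 1 + x * geo x n

-- The binomial coefficient n(n-1)/2, without division.
tri : ℕ → ℕ
tri zero    = 0
tri (suc n) = n + tri n

pow≡1+geo : ∀ z n → suc z ^ n ≡ 1 + z * geo (suc z) n
pow≡1+geo z zero    = cong suc (sym (*-zeroʳ z))
pow≡1+geo z (suc n) = trans (cong (suc z *_) (pow≡1+geo z n)) (lem z (geo (suc z) n))
  where
  lem : ∀ z g → suc z * (1 + z * g) ≡ 1 + z * (1 + suc z * g)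
  lem = solve-∀

-- Binomial expansion of ((1+z)^n - 1)/z up to z². It is the source of every exponent-lifting step:
-- modulo a prime dividing z only `n` survives, and modulo its square only the middle term is added.
geo-expand : ∀ z n → ∃ λ w → geo (suc z) n ≡ n + (z * tri n + z * z * w)
geo-expand z zero    = 0 , sym (cong₂ _+_ (*-zeroʳ z) (*-zeroʳ (z * z)))
geo-expand z (suc n) with geo-expand z n
... | w , eq = tri n + w + z * w ,
               trans (cong (λ g → 1 + suc z * g) eq) (lem z n (tri n) w)
  where
  lem : ∀ z n t w → 1 + suc z * (n + (z * t + z * z * w))
                  ≡ suc n + (z * (n + t) + z * z * (t + w + z * w))
  lem = solve-∀

2*tri : ∀ n → 2 * tri (suc n) ≡ suc n * n
2*tri zero    = refl
2*tri (suc n) = trans (*-distribˡ-+ 2 (suc n) (tri (suc n)))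
                      (trans (cong (2 * suc n +_) (2*tri n)) (lem n))
  where
  lem : ∀ n → 2 * suc n + suc n * n ≡ suc (suc n) * suc n
  lem = solve-∀

geo-lower : ∀ x n → x ^ n ≤ geo x (suc n)
geo-lower x zero    = s≤s z≤n
geo-lower x (suc n) = m≤n⇒m≤1+n (*-monoʳ-≤ x (geo-lower x n))

geo-upper : ∀ x n → 2 ≤ x → geo x (suc n) < 2 * x ^ n
geo-upper x zero    2≤x = s≤s (s≤s (≤-reflexive (*-zeroʳ x)))
geo-upper x (suc n) 2≤x = begin
  2 + x * geo x (suc n)      ≤⟨ +-monoˡ-≤ _ 2≤x ⟩
  x + x * geo x (suc n)      ≡⟨ sym (*-suc x _) ⟩
  x * suc (geo x (suc n))    ≤⟨ *-monoʳ-≤ x (geo-upper x n 2≤x) ⟩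
  x * (2 * x ^ n)            ≡⟨ lem x (x ^ n) ⟩
  2 * (x * x ^ n)            ∎
  where
  open ≤-Reasoning
  lem : ∀ x y → x * (2 * y) ≡ 2 * (x * y)
  lem = solve-∀

-- Primes and prime powers in the natural numbers

prime>1 : ∀ {p} → Prime p → 1 < p
prime>1 pr = nonTrivial⇒n>1 _ {{prime⇒nonTrivial pr}}

prime∣prime : ∀ {s p} → Prime s → Prime p → s ∣ p → s ≡ p
prime∣prime ps pp s∣p with prime⇒irreducible pp s∣p
... | inj₁ refl = contradiction ps ¬prime[1]
... | inj₂ eq   = eq

prime-power-cancel : ∀ {s a b} k → Prime s → ¬ s ∣ b → s ^ k ∣ a * b → s ^ k ∣ a
prime-power-cancel zero ps s∤b _ = 1∣ _
prime-power-cancel {s} {a} {b} (suc k) ps s∤b d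
  with euclidsLemma a b ps (∣-trans (m∣m*n (s ^ k)) d)
... | inj₂ s∣b = contradiction s∣b s∤b
... | inj₁ (divides t refl) =
  subst (s * s ^ k ∣_) (*-comm s t)
    (*-monoʳ-∣ s (prime-power-cancel k ps s∤b
      (*-cancelˡ-∣ s {{prime⇒nonZero ps}}
        (subst (s * s ^ k ∣_) (trans (cong (_* b) (*-comm t s)) (*-assoc s t b)) d))))

prime∣power : ∀ {p m} k → Prime p → p ∣ m ^ k → p ∣ m
prime∣power {p} {m} zero pp d = contradiction (subst Prime (∣1⇒≡1 d) pp) ¬prime[1]
prime∣power {p} {m} (suc k) pp d with euclidsLemma m (m ^ k) pp d
... | inj₁ e = e
... | inj₂ e = prime∣power k pp e

∣power : ∀ {s m} k → 0 < k → s ∣ m → s ∣ m ^ k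
∣power {m = m} (suc k) _ s∣m = ∣m⇒∣m*n (m ^ k) s∣m

exists-prime-factor : ∀ n → 1 < n → ∃ λ p → Prime p × p ∣ n
exists-prime-factor 1 (s≤s ())
exists-prime-factor n@(suc (suc _)) _ with factorise n
... | record { factors = [] ; isFactorisation = () }
... | record { factors = p ∷ ps ; isFactorisation = eq ; factorsPrime = pp ∷ _ } =
  p , pp , subst (p ∣_) (sym eq) (m∣m*n (product ps))

extract-power : ∀ {p} n → Prime p → 0 < n → ∃₂ λ a u → n ≡ p ^ a * u × ¬ p ∣ u × 0 < u
extract-power {p} n pp = <-rec _ step n
  where
  step : ∀ n → (∀ {m} → m < n → 0 < m → ∃₂ λ a u → m ≡ p ^ a * u × ¬ p ∣ u × 0 < u) →
         0 < n → ∃₂ λ a u → n ≡ p ^ a * u × ¬ p ∣ u × 0 < u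
  step n rec n>0 with p ∣? n
  ... | no p∤n = 0 , n , sym (*-identityˡ n) , p∤n , n>0
  step n rec n>0 | yes (divides zero eq) = contradiction (sym eq) (<⇒≢ n>0)
  step n rec n>0 | yes (divides t@(suc _) eq)
    with rec (subst (t <_) (sym eq) (m<m*n t p (prime>1 pp))) (s≤s z≤n)
  ... | a , u , teq , p∤u , u>0 = suc a , u
      , trans eq (trans (*-comm t p) (trans (cong (p *_) teq) (sym (*-assoc p (p ^ a) u))))
      , p∤u , u>0

cofactor< : ∀ {s u n} a → Prime s → 0 < u → n ≡ s ^ a * u → s ∣ n → ¬ s ∣ u → u < n
cofactor< {s} {u} zero ps u>0 eq s∣n s∤u =
  contradiction (subst (s ∣_) (trans eq (*-identityˡ u)) s∣n) s∤u
cofactor< {s} {u} (suc b) ps u>0 eq s∣n s∤u =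
  subst (u <_) (trans (*-comm u (s * s ^ b)) (sym eq))
    (m<m*n u (s * s ^ b) {{>-nonZero u>0}}
      (≤-trans (prime>1 ps) (m≤m*n s (s ^ b) {{m^n≢0 s b {{prime⇒nonZero ps}}}})))

-- Divisibility tested one prime at a time. `X` is an escape: in the application it is the existence
-- of the prime that is sought, which the test at some s may produce instead of a divisibility.
prime-powers⇒∣ : ∀ {X : Set} Q R → 0 < Q →
  (∀ s → Prime s → s ∣ Q → X ⊎ (∀ k → s ^ k ∣ Q → s ^ k ∣ R)) → X ⊎ Q ∣ R
prime-powers⇒∣ {X} Q = <-rec P step Q
  where
  P : ℕ → Set
  P Q = ∀ R → 0 < Q →
    (∀ s → Prime s → s ∣ Q → X ⊎ (∀ k → s ^ k ∣ Q → s ^ k ∣ R)) → X ⊎ Q ∣ R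
  step : ∀ Q → (∀ {Q′} → Q′ < Q → P Q′) → P Q
  step 1 rec R Q>0 h = inj₂ (1∣ R)
  step Q@(suc (suc _)) rec R Q>0 h
    with s , ps , s∣Q ← exists-prime-factor Q (s≤s (s≤s z≤n))
    with a , u , Qeq , s∤u , u>0 ← extract-power Q ps Q>0
    with h s ps s∣Q
  ... | inj₁ x = inj₁ x
  ... | inj₂ hs with hs a (subst (s ^ a ∣_) (sym Qeq) (m∣m*n u))
  ... | divides R′ refl with rec u<Q R′ u>0 h′
    where
    u<Q : u < Q
    u<Q = cofactor< a ps u>0 Qeq s∣Q s∤u
    -- Here t ≠ s, so dividing R by s^a does not affect the powers of t in it.
    h′ : ∀ t → Prime t → t ∣ u → X ⊎ (∀ k → t ^ k ∣ u → t ^ k ∣ R′)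
    h′ t pt t∣u with h t pt (subst (t ∣_) (sym Qeq) (∣n⇒∣m*n (s ^ a) t∣u))
    ... | inj₁ x  = inj₁ x
    ... | inj₂ ht = inj₂ λ k d →
      prime-power-cancel k pt
        (λ t∣s^a → s∤u (subst (_∣ u) (prime∣prime pt ps (prime∣power a pt t∣s^a)) t∣u))
        (ht k (subst (t ^ k ∣_) (sym Qeq) (∣n⇒∣m*n (s ^ a) d)))
  ... | inj₁ x = inj₁ x
  ... | inj₂ u∣R′ = inj₂ (subst₂ _∣_ (trans (*-comm u _) (sym Qeq)) refl (*-monoˡ-∣ (s ^ a) u∣R′))

n<2^n : ∀ n → n < 2 ^ n
n<2^n zero    = s≤s z≤n
n<2^n (suc n) = begin
  1 + suc n        ≤⟨ +-mono-≤ (≤-trans (s≤s z≤n) (n<2^n n)) (n<2^n n) ⟩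
  2 ^ n + 2 ^ n    ≡⟨ cong (2 ^ n +_) (sym (+-identityʳ (2 ^ n))) ⟩
  2 ^ suc n        ∎
  where open ≤-Reasoning

odd-prime∣tri : ∀ {p} → Prime p → p ≢ 2 → p ∣ tri p
odd-prime∣tri {zero} pp _ = contradiction pp ¬prime[0]
odd-prime∣tri {suc n} pp p≢2
  with euclidsLemma 2 (tri (suc n)) pp (subst (suc n ∣_) (sym (2*tri n)) (m∣m*n n))
... | inj₁ d = contradiction (prime∣prime pp prime[2] d) p≢2
... | inj₂ d = d

-- The multiplicative order of q = r + 1

module PowersMinusOne (r : ℕ) where

  q : ℕ
  q = suc r

  pw : ℕ → ℕ
  pw n = q ^ n ∸ 1

  pw≡ : ∀ n → pw n ≡ r * geo q n
  pw≡ n = cong pred (pow≡1+geo r n)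

  suc-pw : ∀ n → q ^ n ≡ suc (pw n)
  suc-pw n = trans (pow≡1+geo r n) (cong suc (sym (pw≡ n)))

  pw-+ : ∀ m n → pw (m + n) ≡ q ^ m * pw n + pw m
  pw-+ m n = suc-injective (begin
    suc (pw (m + n))               ≡⟨ sym (suc-pw (m + n)) ⟩
    q ^ (m + n)                    ≡⟨ ^-distribˡ-+-* q m n ⟩
    q ^ m * q ^ n                  ≡⟨ cong (q ^ m *_) (suc-pw n) ⟩
    q ^ m * suc (pw n)             ≡⟨ *-suc (q ^ m) (pw n) ⟩
    q ^ m + q ^ m * pw n           ≡⟨ cong (_+ q ^ m * pw n) (suc-pw m) ⟩
    suc (pw m + q ^ m * pw n)      ≡⟨ cong suc (+-comm (pw m) _) ⟩
    suc (q ^ m * pw n + pw m)      ∎)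
    where open ≡-Reasoning

  pw-* : ∀ m t → pw (m * t) ≡ pw m * geo (suc (pw m)) t
  pw-* m t = cong pred (begin
    q ^ (m * t)                         ≡⟨ sym (^-*-assoc q m t) ⟩
    (q ^ m) ^ t                         ≡⟨ cong (_^ t) (suc-pw m) ⟩
    suc (pw m) ^ t                      ≡⟨ pow≡1+geo (pw m) t ⟩
    1 + pw m * geo (suc (pw m)) t       ∎)
    where open ≡-Reasoning

  pw-∣ : ∀ {m n} → m ∣ n → pw m ∣ pw n
  pw-∣ {m} (divides t refl) =
    subst (pw m ∣_) (sym (trans (cong pw (*-comm t m)) (pw-* m t))) (m∣m*n _)

  pw>0 : 0 < r → ∀ n → 0 < n → 0 < pw n
  pw>0 r>0 n@(suc m) _ = subst (0 <_) (sym (pw≡ n)) (*-mono-≤ r>0 (s≤s z≤n))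

  -- The order of q modulo `X`, expressed by divisibility of q^m - 1 instead of residue classes.
  -- Minimality is stated with ∣ because only this form is ever applied.
  record Order (X o : ℕ) : Set where
    field
      positive : 0 < o
      divisor  : X ∣ pw o
      minimal  : ∀ m → X ∣ pw m → o ∣ m

  open Order

  exists-order : ∀ X M → 0 < M → X ∣ pw M → ∃ (Order X)
  exists-order X = <-rec _ step
    where
    step : ∀ M → (∀ {m} → m < M → 0 < m → X ∣ pw m → ∃ (Order X)) → 0 < M → X ∣ pw M → ∃ (Order X)
    step M rec M>0 d with anyUpTo? (λ m → (0 <? m) ×-dec (X ∣? pw m)) M
    ... | yes (m , m<M , m>0 , e) = rec m<M m>0 e
    ... | no none = M , record { positive = M>0 ; divisor = d ; minimal = min }
      where
      instance nzM : NonZero M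
      nzM = >-nonZero M>0
      min : ∀ m → X ∣ pw m → M ∣ m
      -- A nonzero remainder would be a smaller positive exponent, which the search has excluded.
      min m e with m % M in eq
      ... | zero = m%n≡0⇒n∣m m M eq
      ... | suc k = contradiction
            (suc k , subst (_< M) eq (m%n<n m M) , s≤s z≤n
              , ∣m+n∣m⇒∣n
                  (subst (X ∣_) (trans (cong pw (trans (m≡m%n+[m/n]*n m M) (cong (_+ m / M * M) eq)))
                                       (pw-+ (suc k) (m / M * M))) e)
                  (∣n⇒∣m*n (q ^ suc k) (∣-trans d (pw-∣ (n∣m*n (m / M))))))
            none

  -- Pigeonhole instead of Fermat: the s powers q^0, ..., q^(s-1) fall into the s - 1 nonzero
  -- residues, and the difference of two colliding exponents is a positive multiple of the order.
  -- Residues are shifted down by one to land in `Fin s′`.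
  order<prime : ∀ {s o} → Prime s → Order s o → o < s
  order<prime {zero} ps _ = contradiction ps ¬prime[0]
  order<prime {s@(suc s′)} {o} ps ord = result (pigeonhole (n<1+n s′) f)
    where
    s∤q^ : ∀ i → ¬ s ∣ q ^ i
    s∤q^ i d = ¬prime[1] (subst Prime (∣1⇒≡1 (∣m+n∣m⇒∣n
      (subst (s ∣_) (trans (suc-pw o) (sym (+-comm _ 1))) (∣power o (positive ord) (prime∣power i ps d)))
      (divisor ord))) ps)
    red : ℕ → ℕ
    red i = q ^ i % s
    red≢0 : ∀ i → red i ≢ 0
    red≢0 i eq = s∤q^ i (m%n≡0⇒n∣m (q ^ i) s eq)
    suc-pred-red : ∀ i → suc (pred (red i)) ≡ red i
    suc-pred-red i = suc-pred (red i) {{≢-nonZero (red≢0 i)}}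
    pred-red< : ∀ i → pred (red i) < s′
    pred-red< i = s≤s⁻¹ (subst (_< s) (sym (suc-pred-red i)) (m%n<n (q ^ i) s))
    f : Fin s → Fin s′
    f i = fromℕ< (pred-red< (toℕ i))
    f≡⇒red≡ : ∀ i j → f i ≡ f j → red (toℕ i) ≡ red (toℕ j)
    f≡⇒red≡ i j eq = trans (sym (suc-pred-red (toℕ i))) (trans (cong suc
      (trans (sym (toℕ-fromℕ< _)) (trans (cong toℕ eq) (toℕ-fromℕ< _)))) (suc-pred-red (toℕ j)))
    diff : ∀ i k → red i ≡ red (i + k) → s ∣ pw k
    diff i k eq with euclidsLemma (q ^ i) (pw k) ps
        (∣m+n∣m⇒∣n (subst (s ∣_) main (n∣m*n ((q ^ (i + k)) / s))) (n∣m*n (q ^ i / s)))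
      where
      open ≡-Reasoning
      main : (q ^ (i + k)) / s * s ≡ q ^ i / s * s + q ^ i * pw k
      main = +-cancelˡ-≡ (red i) _ _ (begin
        red i + (q ^ (i + k)) / s * s           ≡⟨ cong (_+ (q ^ (i + k)) / s * s) eq ⟩
        red (i + k) + (q ^ (i + k)) / s * s     ≡⟨ sym (m≡m%n+[m/n]*n (q ^ (i + k)) s) ⟩
        q ^ (i + k)                             ≡⟨ ^-distribˡ-+-* q i k ⟩
        q ^ i * q ^ k                           ≡⟨ cong (q ^ i *_) (suc-pw k) ⟩
        q ^ i * suc (pw k)                      ≡⟨ *-suc (q ^ i) (pw k) ⟩
        q ^ i + q ^ i * pw k                    ≡⟨ cong (_+ q ^ i * pw k) (m≡m%n+[m/n]*n (q ^ i) s) ⟩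
        red i + q ^ i / s * s + q ^ i * pw k    ≡⟨ +-assoc (red i) _ _ ⟩
        red i + (q ^ i / s * s + q ^ i * pw k)  ∎)
    ... | inj₁ d = contradiction d (s∤q^ i)
    ... | inj₂ d = d
    result : ∃₂ (λ i j → i Fin.< j × f i ≡ f j) → o < s
    result (i , j , i<j , eq) = s≤s (≤-trans
      (∣⇒≤ {{>-nonZero (m<n⇒0<n∸m i<j)}} (minimal ord (toℕ j ∸ toℕ i) (diff (toℕ i) (toℕ j ∸ toℕ i)
        (trans (f≡⇒red≡ i j eq) (cong red (sym (m+[n∸m]≡n (<⇒≤ i<j))))))))
      (≤-trans (m∸n≤m (toℕ j) (toℕ i)) (s≤s⁻¹ (toℕ<n j))))

-- A Zsigmondy-type theorem

peel-prime : ∀ {p d N} j → Prime p → d ∣ N * p ^ suc j →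
             d ∣ N * p ^ j ⊎ ∃ λ e → e ∣ N × d ≡ e * p ^ suc j
peel-prime {p} {d} {N} j pp (divides t eq) with p ∣? t
... | yes (divides t′ refl) = inj₁ (divides t′ (*-cancelˡ-≡ (N * p ^ j) (t′ * d) p {{prime⇒nonZero pp}}
        (trans (lem₁ p N (p ^ j)) (trans eq (lem₂ t′ p d)))))
  where
  lem₁ : ∀ p N w → p * (N * w) ≡ N * (p * w)
  lem₁ = solve-∀
  lem₂ : ∀ t p d → t * p * d ≡ p * (t * d)
  lem₂ = solve-∀
... | no p∤t with prime-power-cancel {a = d} {b = t} (suc j) pp p∤t
                    (subst (p ^ suc j ∣_) (trans eq (*-comm t d)) (n∣m*n N))
...   | divides e refl = inj₂ (e , divides t
          (*-cancelʳ-≡ N (t * e) (p ^ suc j) {{m^n≢0 p (suc j) {{prime⇒nonZero pp}}}}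
            (trans eq (sym (*-assoc t e (p ^ suc j))))) , refl)

∣prime-power : ∀ {p t} k → Prime p → t ∣ p ^ k → ∃ λ i → t ≡ p ^ i
∣prime-power zero pp d = 0 , ∣1⇒≡1 d
∣prime-power {p} {t} (suc k) pp d
  with peel-prime {N = 1} k pp (subst (t ∣_) (sym (*-identityˡ (p ^ suc k))) d)
... | inj₁ e = ∣prime-power k pp (subst (t ∣_) (*-identityˡ (p ^ k)) e)
... | inj₂ (e , e∣1 , eq) = suc k , trans eq (trans (cong (_* p ^ suc k) (∣1⇒≡1 e∣1)) (*-identityˡ _))

sum-map-* : ∀ w cs → sum (map (_* w) cs) ≡ sum cs * w
sum-map-* w []       = refl
sum-map-* w (c ∷ cs) = trans (cong (c * w +_) (sum-map-* w cs)) (sym (*-distribʳ-+ w c (sum cs)))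

product>0 : ∀ {ns} → All (0 <_) ns → 0 < product ns
product>0 []         = s≤s z≤n
product>0 (h ∷ hs)   = *-mono-≤ h (product>0 hs)

-- The cofactors are the N/ℓ for the primes ℓ ∣ N. When every prime of N exceeds the product of the
-- smaller prime powers, the sum of the 1/ℓ stays below 1, as for Sylvester's sequence 2, 3, 7, 43, …
record Chain (N : ℕ) : Set where
  field
    cofactors : List ℕ
    cofactor∣ : All (_∣ N) cofactors
    covers    : ∀ {d} → d ∣ N → d ≡ N ⊎ Any (d ∣_) cofactors
    sum<      : sum cofactors < N
    2^length≤ : 2 ^ length cofactors ≤ N

chain-one : Chain 1
chain-one = record
  { cofactors = [] ; cofactor∣ = [] ; covers = inj₁ ∘ ∣1⇒≡1 ; sum< = s≤s z≤n ; 2^length≤ = ≤-refl }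

-- The new maximal proper divisors are N p^j, for the prime p itself, and the old cofactors times
-- p^(j+1). The hypothesis N < p will come from `order<prime`, N being the order modulo p.
chain-extend : ∀ {N p} → Chain N → Prime p → N < p → ∀ j → Chain (N * p ^ suc j)
chain-extend {N} {p} ch pp N<p j = record
  { cofactors = N * p ^ j ∷ map (_* w) cofactors
  ; cofactor∣ = *-monoʳ-∣ N (n∣m*n p) ∷ AllP.map⁺ (All.map (*-monoˡ-∣ w) cofactor∣)
  ; covers    = cov
  ; sum<      = begin-strict
      -- The old strict inequality leaves room for one more `w` = p^(j+1), and N p^j < w fits into
      -- it because N < p.
      N * p ^ j + sum (map (_* w) cofactors)   ≡⟨ cong (N * p ^ j +_) (sum-map-* w cofactors) ⟩
      N * p ^ j + sum cofactors * w            <⟨ +-monoˡ-< _ (*-monoˡ-< (p ^ j) {{nz}} N<p) ⟩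
      w + sum cofactors * w                    ≤⟨ *-monoˡ-≤ w sum< ⟩
      N * w                                    ∎
  ; 2^length≤ = begin
      2 * 2 ^ length (map (_* w) cofactors)    ≡⟨ cong (λ l → 2 * 2 ^ l) (length-map (_* w) cofactors) ⟩
      2 * 2 ^ length cofactors                 ≤⟨ *-mono-≤ (≤-trans (prime>1 pp) (m≤m*n p (p ^ j) {{nz}})) 2^length≤ ⟩
      w * N                                    ≡⟨ *-comm w N ⟩
      N * w                                    ∎
  }
  where
  open Chain ch
  open ≤-Reasoning
  w = p ^ suc j
  nz : NonZero (p ^ j)
  nz = m^n≢0 p j {{prime⇒nonZero pp}}
  cov : ∀ {d} → d ∣ N * w → d ≡ N * w ⊎ Any (d ∣_) (N * p ^ j ∷ map (_* w) cofactors)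
  cov d∣ with peel-prime {N = N} j pp d∣
  ... | inj₁ h = inj₂ (here h)
  ... | inj₂ (e , e∣N , refl) with covers e∣N
  ...   | inj₁ refl = inj₁ refl
  ...   | inj₂ h    = inj₂ (there (AnyP.map⁺ (Any.map (*-monoˡ-∣ w) h)))

Any⇒∣product : ∀ {x} {cs : List ℕ} (f : ℕ → ℕ) → Any (λ c → x ∣ f c) cs → x ∣ product (map f cs)
Any⇒∣product f (here d)              = ∣m⇒∣m*n _ d
Any⇒∣product {cs = c ∷ _} f (there h) = ∣n⇒∣m*n (f c) (Any⇒∣product f h)

module _ (r : ℕ) where
  open PowersMinusOne r
  open Order

  -- Ensures that p divides 1 + y + ⋯ + y^(p-1) only once when y is a power of q with y ≡ 1 (mod p).
  Regular : ℕ → Set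
  Regular p = p ∣ tri p ⊎ p * p ∣ r

  r∣pw : ∀ n → r ∣ pw n
  r∣pw n = subst (r ∣_) (sym (pw≡ n)) (m∣m*n _)

  -- In p + z `tri p` + z² w, with z = q^m - 1 divisible by p, regularity makes the last two terms
  -- multiples of p², and p itself is not one.
  p²∤geo : ∀ {p} m → Prime p → Regular p → p ∣ pw m → ¬ p * p ∣ geo (suc (pw m)) p
  p²∤geo {p} m pp good p∣z d with geo-expand (pw m) p
  ... | w , eq = <⇒≱ (m<m*n p p {{nz}} (prime>1 pp)) (∣⇒≤ {{nz}} (∣m+n∣m⇒∣n
          (subst (p * p ∣_) (trans eq (+-comm p _)) d)
          (∣m∣n⇒∣m+n (tail good) (∣m⇒∣m*n w (*-pres-∣ p∣z p∣z)))))
    where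
    nz : NonZero p
    nz = prime⇒nonZero pp
    tail : Regular p → p * p ∣ pw m * tri p
    tail (inj₁ h) = *-pres-∣ p∣z h
    tail (inj₂ h) = ∣m⇒∣m*n (tri p) (∣-trans h (r∣pw m))

  -- Modulo s the base is 1, so the geometric sum of t terms is t.
  ∣geo⇒∣ : ∀ {s} z t → s ∣ z → s ∣ geo (suc z) t → s ∣ t
  ∣geo⇒∣ {s} z t s∣z d with geo-expand z t
  ... | w , eq = ∣m+n∣m⇒∣n (subst (s ∣_) (trans eq (+-comm t _)) d)
                   (∣m∣n⇒∣m+n (∣m⇒∣m*n (tri t) s∣z) (∣m⇒∣m*n w (∣m⇒∣m*n z s∣z)))

  ∣⇒∣geo : ∀ {s} z t → s ∣ z → s ∣ t → s ∣ geo (suc z) t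
  ∣⇒∣geo {s} z t s∣z s∣t with geo-expand z t
  ... | w , eq = subst (s ∣_) (sym eq) (∣m∣n⇒∣m+n s∣t
                   (∣m∣n⇒∣m+n (∣m⇒∣m*n (tri t) s∣z) (∣m⇒∣m*n w (∣m⇒∣m*n z s∣z))))

  q^≡ : ∀ m k → suc (pw m) ^ k ≡ q ^ (m * k)
  q^≡ m k = trans (cong (_^ k) (sym (suc-pw m))) (^-*-assoc q m k)

  -- Each quotient is less than twice its leading term q^(c u p′). The factors 2 are counted by the
  -- number of cofactors, and the exponents add up to the sum that `Chain` controls.
  product-geo≤ : ∀ p′ u → 0 < r → 0 < u → ∀ cs → All (0 <_) cs →
    product (map (λ c → geo (suc (pw (c * u))) (suc p′)) cs) ≤ 2 ^ length cs * q ^ (sum cs * (u * p′))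
  product-geo≤ p′ u r>0 u>0 [] [] = ≤-refl
  product-geo≤ p′ u r>0 u>0 (c ∷ cs) (c>0 ∷ cs>0) = begin
    geo x (suc p′) * product (map (λ c → geo (suc (pw (c * u))) (suc p′)) cs)
      ≤⟨ *-mono-≤ (<⇒≤ (geo-upper x p′ (s≤s (pw>0 r>0 (c * u) (*-mono-≤ c>0 u>0)))))
                  (product-geo≤ p′ u r>0 u>0 cs cs>0) ⟩
    2 * x ^ p′ * (2 ^ length cs * Y)
      ≡⟨ lem (x ^ p′) (2 ^ length cs) Y ⟩
    2 * 2 ^ length cs * (x ^ p′ * Y)
      ≡⟨ cong (λ v → 2 * 2 ^ length cs * (v * Y)) (trans (q^≡ (c * u) p′) (cong (q ^_) (*-assoc c u p′))) ⟩
    2 * 2 ^ length cs * (q ^ (c * (u * p′)) * Y)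
      ≡⟨ cong (2 * 2 ^ length cs *_) (sym (^-distribˡ-+-* q (c * (u * p′)) (sum cs * (u * p′)))) ⟩
    2 * 2 ^ length cs * q ^ (c * (u * p′) + sum cs * (u * p′))
      ≡⟨ cong (λ v → 2 * 2 ^ length cs * q ^ v) (sym (*-distribʳ-+ (u * p′) c (sum cs))) ⟩
    2 * 2 ^ length cs * q ^ ((c + sum cs) * (u * p′)) ∎
    where
    open ≤-Reasoning
    x = suc (pw (c * u))
    Y = q ^ (sum cs * (u * p′))
    lem : ∀ a b y → 2 * a * (b * y) ≡ 2 * b * (a * y)
    lem = solve-∀

  module _ (3≤r : 3 ≤ r) where

    r>0 : 0 < r
    r>0 = ≤-trans (s≤s z≤n) 3≤r

    -- Zsigmondy's argument: if no prime had order N p^(j+1), the quotient (q^M-1)/(q^(M/p)-1) with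
    -- M = N p^(j+1) would divide p times the product of the analogous quotients for the cofactors
    -- of N in place of N, which is too small.
    next-prime : ∀ {N p} → Chain N → Prime p → Order p N → Regular p → ∀ j →
                 ∃ λ s → Prime s × Order s (N * p ^ suc j)
    next-prime {N} {p = zero} _ pp = contradiction pp ¬prime[0]
    next-prime {N} {p = p@(suc p′)} ch pp ord good j with prime-powers⇒∣ Q R (s≤s z≤n) local
      where
      open Chain ch
      u = p ^ j
      nzu : NonZero u
      nzu = m^n≢0 p j
      m = N * u
      M = N * p ^ suc j
      Q = geo (suc (pw m)) p
      gs : ℕ → ℕ
      gs c = geo (suc (pw (c * u))) p
      -- The factor p accounts for the prime p, which divides `Q` at most once by regularity; every
      -- other prime power in `Q` has to come from some `gs c`.
      R = p * product (map gs cofactors)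
      M≡ : ∀ c → c * p ^ suc j ≡ c * u * p
      M≡ c = trans (cong (c *_) (*-comm p u)) (sym (*-assoc c u p))
      pwM : ∀ c → pw (c * p ^ suc j) ≡ pw (c * u) * gs c
      pwM c = trans (cong pw (M≡ c)) (pw-* (c * u) p)
      M>0 : 0 < M
      M>0 = *-mono-≤ (positive ord) (m^n>0 p (suc j))
      N<p : N < p
      N<p = order<prime pp ord
      local : ∀ s → Prime s → s ∣ Q → (∃ λ s → Prime s × Order s M) ⊎ (∀ k → s ^ k ∣ Q → s ^ k ∣ R)
      local s ps s∣Q with s ≟ p
      ... | yes refl = inj₂ λ
        { zero → λ _ → 1∣ R
        ; (suc zero) → λ _ → ∣m⇒∣m*n _ (∣-reflexive (*-identityʳ p))
        ; (suc (suc k)) → λ d → contradiction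
            (∣-trans (*-monoʳ-∣ p (m∣m*n (p ^ k))) d)
            (p²∤geo m pp good (∣-trans (divisor ord) (pw-∣ {N} (m∣m*n u)))) }
      ... | no s≢p
        with o , os ← exists-order s M M>0 (subst (s ∣_) (sym (pwM N)) (∣n⇒∣m*n (pw m) s∣Q))
        with peel-prime {N = N} j pp (minimal os M (subst (s ∣_) (sym (pwM N)) (∣n⇒∣m*n (pw m) s∣Q)))
      -- If the order divides m, then q^m ≡ 1 and hence `Q` ≡ p modulo s, which forces s = p.
      ... | inj₁ o∣m = contradiction
              (prime∣prime ps pp (∣geo⇒∣ (pw m) p (∣-trans (divisor os) (pw-∣ o∣m)) s∣Q)) s≢p
      ... | inj₂ (e , e∣N , refl) with covers e∣N
      ...   | inj₁ refl = inj₁ (s , ps , os)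
      ...   | inj₂ h = inj₂ λ k d → ∣n⇒∣m*n p (Any⇒∣product gs (Any.map (λ {c} → go k d {c})
                         (AllAny cofactor∣ h)))
        where
        AllAny : ∀ {P Q : ℕ → Set} {xs} → All P xs → Any Q xs → Any (λ x → P x × Q x) xs
        AllAny (px ∷ _)  (here qx)  = here (px , qx)
        AllAny (_ ∷ pxs) (there qs) = there (AllAny pxs qs)
        -- s exceeds its order e p^(j+1), which is at least p > N. Therefore s cannot divide the
        -- quotient t = N / c below.
        s>N : N < s
        s>N = <-≤-trans N<p (≤-trans (m≤m*n p u {{nzu}}) (≤-trans
          (m≤n*m (p ^ suc j) e {{m*n≢0⇒m≢0 e {{>-nonZero (positive os)}}}}) (<⇒≤ (order<prime ps os))))
        -- With x = c p^(j+1) the order of q modulo s divides x, and (q^M - 1)/(q^x - 1) ≡ t modulo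
        -- s is prime to s. So s^k passes from q^M - 1 to q^x - 1 = (q^(c u) - 1) · `gs c`. The
        -- first factor is prime to s, as otherwise s ∣ q^m - 1 and again s = p.
        go : ∀ k → s ^ k ∣ Q → ∀ {c} → c ∣ N × e ∣ c → s ^ k ∣ gs c
        go k d {c} (divides t N≡ , e∣c) =
          prime-power-cancel {a = gs c} {b = pw (c * u)} k ps s∤z
            (subst (s ^ k ∣_) (trans (pwM c) (*-comm (pw (c * u)) (gs c)))
              (prime-power-cancel {a = pw x} {b = geo (suc (pw x)) t} k ps s∤geo
                (subst (s ^ k ∣_) (trans (cong pw M≡xt) (pw-* x t))
                  (subst (s ^ k ∣_) (sym (pwM N)) (∣n⇒∣m*n (pw m) d)))))
          where
          x = c * p ^ suc j
          M≡xt : M ≡ x * t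
          M≡xt = trans (cong (_* p ^ suc j) N≡) (lem t c (p ^ suc j))
            where
            lem : ∀ t c w → t * c * w ≡ c * w * t
            lem = solve-∀
          s∣pwx : s ∣ pw x
          s∣pwx = ∣-trans (divisor os) (pw-∣ (*-monoˡ-∣ (p ^ suc j) e∣c))
          s∤geo : ¬ s ∣ geo (suc (pw x)) t
          s∤geo h with ∣geo⇒∣ (pw x) t s∣pwx h
          ... | s∣t = <⇒≱ s>N (∣⇒≤ {{>-nonZero (positive ord)}}
                        (∣-trans s∣t (divides c (trans N≡ (*-comm t c)))))
          s∤z : ¬ s ∣ pw (c * u)
          s∤z h = s≢p (prime∣prime ps pp (∣geo⇒∣ (pw m) p
                    (∣-trans h (pw-∣ (*-monoˡ-∣ u (divides t N≡)))) s∣Q))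
    ... | inj₁ found = found
    ... | inj₂ Q∣R = contradiction (∣⇒≤ {{>-nonZero R>0}} Q∣R) (<⇒≱ R<Q)
      where
      open Chain ch
      u = p ^ j
      u>0 : 0 < u
      u>0 = m^n>0 p j
      gs : ℕ → ℕ
      gs c = geo (suc (pw (c * u))) p
      R = p * product (map gs cofactors)
      w = u * p′
      cs>0 : All (0 <_) cofactors
      cs>0 = All.map (λ { (divides t eq) → n≢0⇒n>0 λ { refl →
               <⇒≢ (positive ord) (sym (trans eq (*-zeroʳ t))) } }) cofactor∣
      R>0 : 0 < R
      R>0 = *-mono-≤ {1} {p} {1} (s≤s z≤n) (product>0 (AllP.map⁺ {f = gs} (All.map (λ _ → s≤s z≤n) cofactor∣)))
      2^² : 2 ^ p′ * 2 ^ p′ ≡ 4 ^ p′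
      2^² = trans (sym (^-distribˡ-+-* 2 p′ p′))
              (trans (cong (λ n → 2 ^ (p′ + n)) (sym (+-identityʳ p′))) (sym (^-*-assoc 2 2 p′)))
      open ≤-Reasoning
      -- The losses are p · 2^(number of cofactors) ≤ p N ≤ p (p-1) < 4^(p-1), and q ≥ 4 turns this
      -- into q^(p-1). The gain is q^w with w = u (p-1), because the sum of the cofactors is at most
      -- N - 1.
      R<Q : R < geo (suc (pw (N * u))) p
      R<Q = begin-strict
        p * product (map gs cofactors)
          ≤⟨ *-monoʳ-≤ p (product-geo≤ p′ u r>0 u>0 cofactors cs>0) ⟩
        p * (2 ^ length cofactors * q ^ (sum cofactors * w))
          ≡⟨ sym (*-assoc p (2 ^ length cofactors) _) ⟩
        p * 2 ^ length cofactors * q ^ (sum cofactors * w)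
          ≤⟨ *-monoˡ-≤ _ (*-monoʳ-≤ p (≤-trans 2^length≤ (s≤s⁻¹ (order<prime pp ord)))) ⟩
        p * p′ * q ^ (sum cofactors * w)
          <⟨ *-monoˡ-< _ {{m^n≢0 q (sum cofactors * w)}} (*-monoʳ-< p (n<2^n p′)) ⟩
        p * 2 ^ p′ * q ^ (sum cofactors * w)
          ≤⟨ *-monoˡ-≤ _ (*-monoˡ-≤ (2 ^ p′) (n<2^n p′)) ⟩
        2 ^ p′ * 2 ^ p′ * q ^ (sum cofactors * w)
          ≡⟨ cong (_* q ^ (sum cofactors * w)) 2^² ⟩
        4 ^ p′ * q ^ (sum cofactors * w)
          ≤⟨ *-monoˡ-≤ _ (^-monoˡ-≤ p′ (s≤s 3≤r)) ⟩
        q ^ p′ * q ^ (sum cofactors * w)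
          ≤⟨ *-monoˡ-≤ _ (^-monoʳ-≤ q (m≤n*m p′ u {{>-nonZero u>0}})) ⟩
        q ^ w * q ^ (sum cofactors * w)
          ≡⟨ sym (^-distribˡ-+-* q w (sum cofactors * w)) ⟩
        q ^ (suc (sum cofactors) * w)
          ≤⟨ ^-monoʳ-≤ q (*-monoˡ-≤ w sum<) ⟩
        q ^ (N * w)
          ≡⟨ cong (q ^_) (sym (*-assoc N u p′)) ⟩
        q ^ (N * u * p′)
          ≡⟨ sym (q^≡ (N * u) p′) ⟩
        suc (pw (N * u)) ^ p′
          ≤⟨ geo-lower (suc (pw (N * u))) p′ ⟩
        geo (suc (pw (N * u))) p ∎

-- Valuations of products and the growth of N

indicator : ∀ {P : Set} → Dec P → ℕ
indicator (yes _) = 1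
indicator (no _)  = 0

indicator-yes : ∀ {P : Set} (d : Dec P) → P → indicator d ≡ 1
indicator-yes (yes _) _ = refl
indicator-yes (no ¬p) p = contradiction p ¬p

indicator-no : ∀ {P : Set} (d : Dec P) → ¬ P → indicator d ≡ 0
indicator-no (yes p) ¬p = contradiction p ¬p
indicator-no (no _)  _  = refl

indicator-cong : ∀ {P Q : Set} (d : Dec P) (e : Dec Q) → (P → Q) → (Q → P) → indicator d ≡ indicator e
indicator-cong (yes p) e f g = sym (indicator-yes e (f p))
indicator-cong (no ¬p) e f g = sym (indicator-no e (¬p ∘ g))

Σ< : ℕ → (ℕ → ℕ) → ℕ
Σ< zero    f = 0
Σ< (suc K) f = f K + Σ< K f

Σ<-cong : ∀ K {f g : ℕ → ℕ} → (∀ k → f k ≡ g k) → Σ< K f ≡ Σ< K g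
Σ<-cong zero    h = refl
Σ<-cong (suc K) h = cong₂ _+_ (h K) (Σ<-cong K h)

Σ<-+ : ∀ K (f g : ℕ → ℕ) → Σ< K (λ k → f k + g k) ≡ Σ< K f + Σ< K g
Σ<-+ zero    f g = refl
Σ<-+ (suc K) f g = trans (cong (f K + g K +_) (Σ<-+ K f g)) (lem (f K) (g K) (Σ< K f) (Σ< K g))
  where
  lem : ∀ a b c d → a + b + (c + d) ≡ (a + c) + (b + d)
  lem = solve-∀

Σ<-zero : ∀ K → Σ< K (λ _ → 0) ≡ 0
Σ<-zero zero    = refl
Σ<-zero (suc K) = Σ<-zero K

-- Extracts a witness from a comparison of sums. The hypothesis is an inequality even where it is
-- applied to equal sums, since removing a top term with f K ≤ g K preserves only that.
Σ<-compare : ∀ K (f g : ℕ → ℕ) → Σ< K g ≤ Σ< K f →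
             (∃ λ k → g k < f k) ⊎ (∀ k → k < K → f k ≡ g k) × Σ< K f ≡ Σ< K g
Σ<-compare zero    f g h = inj₂ ((λ _ ()) , refl)
Σ<-compare (suc K) f g h with g K <? f K
... | yes lt = inj₁ (K , lt)
... | no  ¬lt with Σ<-compare K f g (+-cancelˡ-≤ (g K) _ _ (≤-trans h (+-monoˡ-≤ _ (≮⇒≥ ¬lt))))
...   | inj₁ found = inj₁ found
...   | inj₂ (eqs , total) = inj₂ (pointwise-≡ , cong₂ _+_ eqK total)
  where
  eqK : f K ≡ g K
  eqK = ≤-antisym (≮⇒≥ ¬lt) (+-cancelʳ-≤ (Σ< K g) _ _ (≤-trans h (≤-reflexive (cong (f K +_) total))))
  pointwise-≡ : ∀ k → k < suc K → f k ≡ g k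
  pointwise-≡ k k<1+K with k ≟ K
  ... | yes refl = eqK
  ... | no k≢K   = eqs k (≤∧≢⇒< (s≤s⁻¹ k<1+K) k≢K)

-- The exponent of p in x as long as it is at most K.
valuation : ℕ → ℕ → ℕ → ℕ
valuation K p x = Σ< K (λ k → indicator (p ^ suc k ∣? x))

^-mono-∣ : ∀ p {m n} → m ≤ n → p ^ m ∣ p ^ n
^-mono-∣ p {m} {n} m≤n = subst (λ k → p ^ m ∣ p ^ k) (m+[n∸m]≡n m≤n)
  (subst (p ^ m ∣_) (sym (^-distribˡ-+-* p m (n ∸ m))) (m∣m*n _))

valuation-saturated : ∀ {p u} K a → K ≤ a → valuation K p (p ^ a * u) ≡ K
valuation-saturated zero a _ = refl
valuation-saturated {p} {u} (suc K) a K<a =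
  cong₂ _+_ (indicator-yes (p ^ suc K ∣? p ^ a * u) (∣m⇒∣m*n u (^-mono-∣ p K<a)))
            (valuation-saturated {p} {u} K a (<⇒≤ K<a))

valuation-exact : ∀ {p u} K a → Prime p → ¬ p ∣ u → a ≤ K → valuation K p (p ^ a * u) ≡ a
valuation-exact zero zero _ _ _ = refl
valuation-exact {p} {u} (suc K) a pp p∤u a≤1+K with a ≟ suc K
... | yes refl = valuation-saturated {p} {u} (suc K) a ≤-refl
... | no a≢ = cong₂ _+_ (indicator-no (p ^ suc K ∣? p ^ a * u) too-big) (valuation-exact K a pp p∤u a≤K)
  where
  a≤K : a ≤ K
  a≤K = s≤s⁻¹ (≤∧≢⇒< a≤1+K a≢)
  too-big : ¬ p ^ suc K ∣ p ^ a * u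
  too-big d = p∤u (*-cancelˡ-∣ (p ^ a) {{m^n≢0 p a {{prime⇒nonZero pp}}}}
    (∣-trans (subst (_∣ p ^ suc K) (*-comm p (p ^ a)) (^-mono-∣ p (s≤s a≤K))) d))

-- A crude bound that makes the number itself a large enough cutoff `K` for its valuation.
exponent≤ : ∀ {p u} a → Prime p → 0 < u → a ≤ p ^ a * u
exponent≤ {p} {u} a pp u>0 = begin
  a             ≤⟨ <⇒≤ (n<2^n a) ⟩
  2 ^ a         ≤⟨ ^-monoˡ-≤ a (prime>1 pp) ⟩
  p ^ a         ≤⟨ m≤m*n (p ^ a) u {{>-nonZero u>0}} ⟩
  p ^ a * u     ∎
  where open ≤-Reasoning

valuation-* : ∀ {p} K x y → Prime p → 0 < x → 0 < y → x * y ≤ K →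
              valuation K p (x * y) ≡ valuation K p x + valuation K p y
valuation-* {p} K x y pp x>0 y>0 xy≤K
  with a , u , refl , p∤u , u>0 ← extract-power x pp x>0
  with b , v , refl , p∤v , v>0 ← extract-power y pp y>0 =
  begin
    valuation K p (x * y)                  ≡⟨ cong (valuation K p) xy≡ ⟩
    valuation K p (p ^ (a + b) * (u * v))  ≡⟨ valuation-exact K (a + b) pp p∤uv a+b≤K ⟩
    a + b                                  ≡⟨ sym (cong₂ _+_ (valuation-exact K a pp p∤u (≤-trans (m≤m+n a b) a+b≤K))
                                                             (valuation-exact K b pp p∤v (≤-trans (m≤n+m b a) a+b≤K))) ⟩
    valuation K p x + valuation K p y      ∎
  where
  open ≡-Reasoning
  p∤uv : ¬ p ∣ u * v
  p∤uv d with euclidsLemma u v pp d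
  ... | inj₁ e = p∤u e
  ... | inj₂ e = p∤v e
  lem : ∀ a u b v → a * u * (b * v) ≡ a * b * (u * v)
  lem = solve-∀
  xy≡ : p ^ a * u * (p ^ b * v) ≡ p ^ (a + b) * (u * v)
  xy≡ = trans (lem (p ^ a) u (p ^ b) v) (cong (_* (u * v)) (sym (^-distribˡ-+-* p a b)))
  a+b≤K : a + b ≤ K
  a+b≤K = ≤-trans (exponent≤ (a + b) pp (*-mono-≤ u>0 v>0)) (≤-trans (≤-reflexive (sym xy≡)) xy≤K)

count : ℕ → List ℕ → ℕ
count d []       = 0
count d (n ∷ ns) = indicator (d ∣? n) + count d ns

count-one : ∀ ns → count 1 ns ≡ length ns
count-one []       = refl
count-one (n ∷ ns) = cong₂ _+_ (indicator-yes (1 ∣? n) (1∣ n)) (count-one ns)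

count-large : ∀ {d} ns → All (0 <_) ns → sum ns < d → count d ns ≡ 0
count-large [] [] _ = refl
count-large {d} (n ∷ ns) (n>0 ∷ ns>0) h = cong₂ _+_
  (indicator-no (d ∣? n) (>⇒∤ {{>-nonZero n>0}} (≤-<-trans (m≤m+n n (sum ns)) h)))
  (count-large ns ns>0 (≤-<-trans (m≤n+m (sum ns) n) h))

module _ (r : ℕ) (3≤r : 3 ≤ r) where
  open PowersMinusOne r
  open Order

  module _ {p N} (pp : Prime p) (ord : Order p N) where

    -- Multiplying the exponent by p gains a factor p, because (q^(m p) - 1)/(q^m - 1) ≡ p ≡ 0
    -- modulo p once p ∣ q^m - 1. This bounds the order modulo p^(k+1) from above.
    prime-power∣pw : ∀ k → p ^ suc k ∣ pw (N * p ^ k)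
    prime-power∣pw zero = subst₂ _∣_ (sym (*-identityʳ p)) (cong pw (sym (*-identityʳ N))) (divisor ord)
    prime-power∣pw (suc k) = subst₂ _∣_ (*-comm (p ^ suc k) p)
      (sym (trans (cong pw (trans (cong (N *_) (*-comm p (p ^ k))) (sym (*-assoc N (p ^ k) p)))) (pw-* m p)))
      (*-pres-∣ (prime-power∣pw k)
        (∣⇒∣geo r (pw m) p (∣-trans (m∣m*n (p ^ k)) (prime-power∣pw k)) ∣-refl))
      where m = N * p ^ k

    order-of-power : ∀ k → ∃ (Order (p ^ suc k))
    order-of-power k = exists-order (p ^ suc k) (N * p ^ k)
      (*-mono-≤ (positive ord) (m^n>0 p {{prime⇒nonZero pp}} k)) (prime-power∣pw k)

    -- Shifted by one: this is the order of q modulo p^(k+1), so that k = 0 gives N.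
    ord^ : ℕ → ℕ
    ord^ k = proj₁ (order-of-power k)

    N∣ord^ : ∀ k → N ∣ ord^ k
    N∣ord^ k = minimal ord _ (∣-trans (m∣m*n (p ^ k)) (divisor (proj₂ (order-of-power k))))

    ord^0 : ord^ 0 ≡ N
    ord^0 = ∣-antisym (minimal (proj₂ (order-of-power 0)) N
              (subst (_∣ pw N) (sym (*-identityʳ p)) (divisor ord))) (N∣ord^ 0)

    -- The order modulo p^(k+1) is a multiple of N, the order modulo p, and a divisor of N p^k.
    ord^-form : ∀ k → ∃ λ i → ord^ k ≡ N * p ^ i
    ord^-form k with N∣ord^ k
    ... | divides t eq
      with i , t≡ ← ∣prime-power k pp (*-cancelˡ-∣ N {{>-nonZero (positive ord)}}
             (subst (_∣ N * p ^ k) (trans eq (*-comm t N))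
               (minimal (proj₂ (order-of-power k)) _ (prime-power∣pw k))))
      = i , trans eq (trans (*-comm t N) (cong (N *_) t≡))

    valuation-pw : ∀ K n → valuation K p (pw n) ≡ Σ< K (λ k → indicator (ord^ k ∣? n))
    valuation-pw K n = Σ<-cong K λ k → indicator-cong (p ^ suc k ∣? pw n) (ord^ k ∣? n)
      (minimal (proj₂ (order-of-power k)) n)
      (λ d → ∣-trans (divisor (proj₂ (order-of-power k))) (pw-∣ d))

    valuation-product : ∀ K ns → All (0 <_) ns → product (map pw ns) ≤ K →
      valuation K p (product (map pw ns)) ≡ Σ< K (λ k → count (ord^ k) ns)
    valuation-product K [] [] _ =
      trans (valuation-exact {p} {1} K 0 pp (λ d → ¬prime[1] (subst Prime (∣1⇒≡1 d) pp)) z≤n)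
            (sym (Σ<-zero K))
    valuation-product K (n ∷ ns) (n>0 ∷ ns>0) h = begin
      valuation K p (pw n * rest)
        ≡⟨ valuation-* K (pw n) rest pp pwn>0 rest>0 h ⟩
      valuation K p (pw n) + valuation K p rest
        ≡⟨ cong₂ _+_ (valuation-pw K n) (valuation-product K ns ns>0
             (≤-trans (m≤n*m rest (pw n) {{>-nonZero pwn>0}}) h)) ⟩
      Σ< K (λ k → indicator (ord^ k ∣? n)) + Σ< K (λ k → count (ord^ k) ns)
        ≡⟨ sym (Σ<-+ K _ _) ⟩
      Σ< K (λ k → count (ord^ k) (n ∷ ns)) ∎
      where
      open ≡-Reasoning
      rest = product (map pw ns)
      pwn>0 : 0 < pw n
      pwn>0 = pw>0 (r>0 r 3≤r) n n>0
      rest>0 : 0 < rest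
      rest>0 = product>0 (AllP.map⁺ (All.map (λ {m} → pw>0 (r>0 r 3≤r) m) ns>0))

    -- The exponent of p in ∏ (q^n-1) is the sum over k of the number of n divisible by the order of q
    -- modulo p^k; these orders are N p^i, so an imbalance at N forces one at some N p^i with i > 0.
    climb : ∀ A B → All (0 <_) A → All (0 <_) B → product (map pw A) ≡ product (map pw B) →
            count N A < count N B → ∃ λ j → count (N * p ^ suc j) B < count (N * p ^ suc j) A
    climb A B A>0 B>0 eq lt with Σ<-compare K (λ k → count (ord^ k) A) (λ k → count (ord^ k) B)
        (≤-reflexive (trans (sym (valuation-product K B B>0 (≤-reflexive (sym eq))))
          (trans (cong (valuation K p) (sym eq)) (valuation-product K A A>0 ≤-refl))))
      where K = product (map pw A)
    ... | inj₂ (eqs , _) = contradiction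
            (subst (λ o → count o A ≡ count o B) ord^0
              (eqs 0 (product>0 (AllP.map⁺ (All.map (λ {m} → pw>0 (r>0 r 3≤r) m) A>0)))))
            (<⇒≢ lt)
    ... | inj₁ (k , found) with ord^-form k
    -- i = 0 is the level N itself, where the counts compare the other way round.
    ...   | zero  , o≡ = contradiction (subst (λ o → count o B < count o A) (trans o≡ (*-identityʳ N)) found) (<⇒≯ lt)
    ...   | suc j , o≡ = j , subst (λ o → count o B < count o A) o≡ found

  climb-≢ : ∀ {p N} → Prime p → Order p N → ∀ A B → All (0 <_) A → All (0 <_) B →
    product (map pw A) ≡ product (map pw B) → count N A ≢ count N B →
    ∃ λ j → count (N * p ^ suc j) A ≢ count (N * p ^ suc j) B
  climb-≢ {N = N} pp ord A B A>0 B>0 eq ne with <-cmp (count N A) (count N B)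
  ... | tri≈ _ e _ = contradiction e ne
  ... | tri< lt _ _ with j , h ← climb pp ord A B A>0 B>0 eq lt = j , ≢-sym (<⇒≢ h)
  ... | tri> _ _ gt with j , h ← climb pp ord B A B>0 A>0 (sym eq) gt = j , <⇒≢ h

  -- An odd prime divisor is regular, and so is 2 if 4 ∣ r. If r = 2u with u odd, then r ≥ 3 gives u
  -- > 1 and an odd prime divides u. The values r = 1 and r = 2 have no such prime.
  first-prime : ∃ λ p → Prime p × p ∣ r × Regular r p
  first-prime with 4 ∣? r
  ... | yes 4∣r = 2 , prime[2] , ∣-trans (divides 2 refl) 4∣r , inj₂ 4∣r
  ... | no 4∤r with 2 ∣? r
  ...   | no 2∤r with p , pp , p∣r ← exists-prime-factor r (≤-trans (s≤s (s≤s z≤n)) 3≤r)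
          = p , pp , p∣r , inj₁ (odd-prime∣tri pp λ { refl → 2∤r p∣r })
  ...   | yes (divides u r≡) with p , pp , p∣u ← exists-prime-factor u (*-cancelʳ-< 2 1 u (subst (2 <_) r≡ 3≤r))
          = p , pp , ∣-trans p∣u (divides 2 (trans r≡ (*-comm u 2)))
          , inj₁ (odd-prime∣tri pp λ { refl → 4∤r (subst (4 ∣_) (sym r≡) (*-monoˡ-∣ 2 p∣u)) })

  -- N grows at every round, so `fuel` measures how far it is from exceeding all exponents; beyond
  -- `sum A + sum B` both counts vanish. The chain carries the history of N that `next-prime`
  -- requires.
  no-discrepancy : ∀ A B → All (0 <_) A → All (0 <_) B → product (map pw A) ≡ product (map pw B) →
    ∀ fuel {N p} → sum A + sum B < N + fuel → Chain N → Prime p → Order p N → Regular r p →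
    count N A ≡ count N B
  no-discrepancy A B A>0 B>0 eq zero {N} bound _ _ _ _ =
    trans (count-large A A>0 (≤-<-trans (m≤m+n (sum A) (sum B)) bound′))
          (sym (count-large B B>0 (≤-<-trans (m≤n+m (sum B) (sum A)) bound′)))
    where
    bound′ : sum A + sum B < N
    bound′ = subst (sum A + sum B <_) (+-identityʳ N) bound
  no-discrepancy A B A>0 B>0 eq (suc fuel) {N} {p} bound ch pp ord good with count N A ≟ count N B
  ... | yes e = e
  ... | no ne
    with j , ne′ ← climb-≢ pp ord A B A>0 B>0 eq ne
    with s , ps , os ← next-prime r 3≤r ch pp ord good j
    = contradiction
        (no-discrepancy A B A>0 B>0 eq fuel (<-≤-trans bound
            (≤-trans (≤-reflexive (+-suc N fuel)) (+-monoˡ-≤ fuel N<N′)))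
          (chain-extend ch pp (order<prime pp ord) j) ps os
          -- The new prime exceeds its order, which is greater than N ≥ 1; hence it is not 2.
          (inj₁ (odd-prime∣tri ps λ { refl → <⇒≱ (order<prime ps os) (≤-trans (s≤s (positive ord)) N<N′) })))
        ne′
    where
    N<N′ : N < N * p ^ suc j
    N<N′ = m<m*n N (p ^ suc j) {{>-nonZero (positive ord)}}
             (≤-trans (prime>1 pp) (m≤m*n p (p ^ j) {{m^n≢0 p j {{prime⇒nonZero pp}}}}))

  equal-products⇒equal-lengths : ∀ A B → All (0 <_) A → All (0 <_) B →
    product (map pw A) ≡ product (map pw B) → length A ≡ length B
  equal-products⇒equal-lengths A B A>0 B>0 eq with p , pp , p∣r , good ← first-prime =
    trans (sym (count-one A)) (trans
      (no-discrepancy A B A>0 B>0 eq (sum A + sum B) ≤-refl chain-one pp ord₁ good)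
      (count-one B))
    where
    ord₁ : Order p 1
    ord₁ = record { positive = s≤s z≤n ; divisor = ∣-trans p∣r (r∣pw r 1) ; minimal = λ m _ → 1∣ m }

-- Polynomials over a finite field

module Polynomials {q : ℕ} (𝔽 : FiniteField q) where
  open FiniteField 𝔽 renaming (_+_ to infixl 6 _⊕_; _*_ to infixl 7 _⊗_; -_ to infix 8 ⊖_; _≟_ to _≟F_)
  open FF 𝔽

  coefficientRing : CommutativeRing _ _
  coefficientRing = record { isCommutativeRing = isCommutativeRing }

  private
    module K = CommutativeRing coefficientRing
  open CommutativeSemigroupProperties K.+-commutativeSemigroup using (interchange)

  coef : Poly → ℕ → Carrier
  coef []      _       = 0#
  coef (a ∷ f) zero    = a
  coef (a ∷ f) (suc n) = coef f n

  infix 4 _≈_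
  -- Equality up to trailing zeros, which the ring laws need on unnormalised lists. As a record it
  -- lets `f` and `g` be inferred.
  record _≈_ (f g : Poly) : Set where
    constructor pointwise
    field at : ∀ n → coef f n ≡ coef g n
  open _≈_

  ≈-isEquivalence : IsEquivalence _≈_
  ≈-isEquivalence = record
    { refl  = pointwise λ _ → refl
    ; sym   = λ e → pointwise λ n → sym (at e n)
    ; trans = λ e e′ → pointwise λ n → trans (at e n) (at e′ n)
    }

  ≈-setoid : Setoid _ _
  ≈-setoid = record { isEquivalence = ≈-isEquivalence }

  open IsEquivalence ≈-isEquivalence public using ()
    renaming (refl to ≈-refl; sym to ≈-sym; trans to ≈-trans; reflexive to ≈-reflexive)
  module ≈-Reasoning where
    open import Relation.Binary.Reasoning.Setoid ≈-setoid public

  scale : Carrier → Poly → Poly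
  scale a = map (a ⊗_)

  coef-padd : ∀ f g n → coef (padd f g) n ≡ coef f n ⊕ coef g n
  coef-padd []      g       n       = sym (K.+-identityˡ _)
  coef-padd (a ∷ f) []      n       = sym (K.+-identityʳ _)
  coef-padd (a ∷ f) (b ∷ g) zero    = refl
  coef-padd (a ∷ f) (b ∷ g) (suc n) = coef-padd f g n

  coef-scale : ∀ a f n → coef (scale a f) n ≡ a ⊗ coef f n
  coef-scale a []      n       = sym (K.zeroʳ a)
  coef-scale a (b ∷ f) zero    = refl
  coef-scale a (b ∷ f) (suc n) = coef-scale a f n

  ∷-cong : ∀ {a b f g} → a ≡ b → f ≈ g → a ∷ f ≈ b ∷ g
  ∷-cong a≡b f≈g = pointwise λ { zero → a≡b ; (suc n) → at f≈g n }

  tail-cong : ∀ {a b f g} → a ∷ f ≈ b ∷ g → f ≈ g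
  tail-cong e = pointwise (at e ∘ suc)

  0∷[]≈[] : 0# ∷ [] ≈ []
  0∷[]≈[] = pointwise λ { zero → refl ; (suc n) → refl }

  0∷-zero : ∀ {f} → f ≈ [] → 0# ∷ f ≈ []
  0∷-zero e = ≈-trans (∷-cong refl e) 0∷[]≈[]

  padd-cong : ∀ {f f′ g g′} → f ≈ f′ → g ≈ g′ → padd f g ≈ padd f′ g′
  padd-cong {f} {f′} {g} {g′} e e′ = pointwise λ n →
    trans (coef-padd f g n) (trans (cong₂ _⊕_ (at e n) (at e′ n)) (sym (coef-padd f′ g′ n)))

  padd-comm : ∀ f g → padd f g ≈ padd g f
  padd-comm f g = pointwise λ n →
    trans (coef-padd f g n) (trans (K.+-comm _ _) (sym (coef-padd g f n)))

  padd-assoc : ∀ f g h → padd (padd f g) h ≈ padd f (padd g h)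
  padd-assoc f g h = pointwise λ n → begin
    coef (padd (padd f g) h) n            ≡⟨ coef-padd (padd f g) h n ⟩
    coef (padd f g) n ⊕ coef h n          ≡⟨ cong (_⊕ coef h n) (coef-padd f g n) ⟩
    coef f n ⊕ coef g n ⊕ coef h n        ≡⟨ K.+-assoc _ _ _ ⟩
    coef f n ⊕ (coef g n ⊕ coef h n)      ≡⟨ cong (coef f n ⊕_) (sym (coef-padd g h n)) ⟩
    coef f n ⊕ coef (padd g h) n          ≡⟨ sym (coef-padd f (padd g h) n) ⟩
    coef (padd f (padd g h)) n            ∎
    where open ≡-Reasoning

  padd-identityʳ : ∀ f → padd f [] ≈ f
  padd-identityʳ f = padd-comm f []

  scale-cong : ∀ {a b f g} → a ≡ b → f ≈ g → scale a f ≈ scale b g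
  scale-cong {a} {b} {f} {g} a≡b e = pointwise λ n →
    trans (coef-scale a f n) (trans (cong₂ _⊗_ a≡b (at e n)) (sym (coef-scale b g n)))

  scale-1 : ∀ f → scale 1# f ≈ f
  scale-1 f = pointwise λ n → trans (coef-scale 1# f n) (K.*-identityˡ _)

  scale-0 : ∀ f → scale 0# f ≈ []
  scale-0 f = pointwise λ n → trans (coef-scale 0# f n) (K.zeroˡ _)

  scale-scale : ∀ a b f → scale a (scale b f) ≈ scale (a ⊗ b) f
  scale-scale a b f = pointwise λ n → trans (coef-scale a (scale b f) n)
    (trans (cong (a ⊗_) (coef-scale b f n)) (trans (sym (K.*-assoc a b _)) (sym (coef-scale (a ⊗ b) f n))))

  scale-padd : ∀ a f g → scale a (padd f g) ≈ padd (scale a f) (scale a g)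
  scale-padd a f g = pointwise λ n → begin
    coef (scale a (padd f g)) n                ≡⟨ coef-scale a (padd f g) n ⟩
    a ⊗ coef (padd f g) n                      ≡⟨ cong (a ⊗_) (coef-padd f g n) ⟩
    a ⊗ (coef f n ⊕ coef g n)                  ≡⟨ K.distribˡ a _ _ ⟩
    a ⊗ coef f n ⊕ a ⊗ coef g n                ≡⟨ sym (cong₂ _⊕_ (coef-scale a f n) (coef-scale a g n)) ⟩
    coef (scale a f) n ⊕ coef (scale a g) n    ≡⟨ sym (coef-padd (scale a f) (scale a g) n) ⟩
    coef (padd (scale a f) (scale a g)) n      ∎
    where open ≡-Reasoning

  scale-⊕ : ∀ a b f → scale (a ⊕ b) f ≈ padd (scale a f) (scale b f)
  scale-⊕ a b f = pointwise λ n → begin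
    coef (scale (a ⊕ b) f) n                   ≡⟨ coef-scale (a ⊕ b) f n ⟩
    (a ⊕ b) ⊗ coef f n                         ≡⟨ K.distribʳ _ a b ⟩
    a ⊗ coef f n ⊕ b ⊗ coef f n                ≡⟨ sym (cong₂ _⊕_ (coef-scale a f n) (coef-scale b f n)) ⟩
    coef (scale a f) n ⊕ coef (scale b f) n    ≡⟨ sym (coef-padd (scale a f) (scale b f) n) ⟩
    coef (padd (scale a f) (scale b f)) n      ∎
    where open ≡-Reasoning

  padd-medial : ∀ f g h k → padd (padd f g) (padd h k) ≈ padd (padd f h) (padd g k)
  padd-medial f g h k = pointwise λ n →
    trans (coef² f g h k n) (trans (interchange _ _ _ _) (sym (coef² f h g k n)))
    where
    coef² : ∀ f g h k n → coef (padd (padd f g) (padd h k)) n ≡ (coef f n ⊕ coef g n) ⊕ (coef h n ⊕ coef k n)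
    coef² f g h k n = trans (coef-padd (padd f g) (padd h k) n) (cong₂ _⊕_ (coef-padd f g n) (coef-padd h k n))

  padd-swap : ∀ f g h → padd f (padd g h) ≈ padd g (padd f h)
  padd-swap f g h = ≈-trans (≈-sym (padd-assoc f g h))
    (≈-trans (padd-cong (padd-comm f g) ≈-refl) (padd-assoc g f h))

  pmul-congʳ : ∀ f {g g′} → g ≈ g′ → pmul f g ≈ pmul f g′
  pmul-congʳ []      e = ≈-refl
  pmul-congʳ (a ∷ f) e = padd-cong (scale-cong refl e) (∷-cong refl (pmul-congʳ f e))

  pmul-zeroʳ : ∀ f → pmul f [] ≈ []
  pmul-zeroʳ []      = ≈-refl
  pmul-zeroʳ (a ∷ f) = 0∷-zero (pmul-zeroʳ f)

  pmul-∷ʳ : ∀ f b g → pmul f (b ∷ g) ≈ padd (scale b f) (0# ∷ pmul f g)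
  pmul-∷ʳ []      b g = ≈-sym 0∷[]≈[]
  pmul-∷ʳ (a ∷ f) b g = ∷-cong (cong (_⊕ 0#) (K.*-comm a b))
    (≈-trans (padd-cong (≈-refl {scale a g}) (pmul-∷ʳ f b g)) (padd-swap (scale a g) (scale b f) (0# ∷ pmul f g)))

  pmul-comm : ∀ f g → pmul f g ≈ pmul g f
  pmul-comm []      g = ≈-sym (pmul-zeroʳ g)
  pmul-comm (a ∷ f) g = ≈-trans (padd-cong ≈-refl (∷-cong refl (pmul-comm f g))) (≈-sym (pmul-∷ʳ g a f))

  pmul-cong : ∀ {f f′ g g′} → f ≈ f′ → g ≈ g′ → pmul f g ≈ pmul f′ g′
  pmul-cong {f} {f′} {g} {g′} e e′ = ≈-trans (pmul-congʳ f e′)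
    (≈-trans (pmul-comm f g′) (≈-trans (pmul-congʳ g′ e) (pmul-comm g′ f′)))

  pmul-distribˡ : ∀ f g h → pmul f (padd g h) ≈ padd (pmul f g) (pmul f h)
  pmul-distribˡ []      g h = ≈-refl
  pmul-distribˡ (a ∷ f) g h = ≈-trans
    (padd-cong (scale-padd a g h)
      (≈-trans (∷-cong (sym (K.+-identityˡ 0#)) (pmul-distribˡ f g h))
               (≈-refl {padd (0# ∷ pmul f g) (0# ∷ pmul f h)})))
    (padd-medial (scale a g) (scale a h) (0# ∷ pmul f g) (0# ∷ pmul f h))

  pmul-distribʳ : ∀ f g h → pmul (padd g h) f ≈ padd (pmul g f) (pmul h f)
  pmul-distribʳ f g h = ≈-trans (pmul-comm (padd g h) f)
    (≈-trans (pmul-distribˡ f g h) (padd-cong (pmul-comm f g) (pmul-comm f h)))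

  scale-pmul : ∀ a f g → pmul (scale a f) g ≈ scale a (pmul f g)
  scale-pmul a []      g = ≈-refl
  scale-pmul a (b ∷ f) g = ≈-trans
    (padd-cong (≈-sym (scale-scale a b g)) (∷-cong (sym (K.zeroʳ a)) (scale-pmul a f g)))
    (≈-sym (scale-padd a (scale b g) (0# ∷ pmul f g)))

  pmul-scale : ∀ a f g → pmul f (scale a g) ≈ scale a (pmul f g)
  pmul-scale a f g = ≈-trans (pmul-comm f (scale a g))
    (≈-trans (scale-pmul a g f) (scale-cong refl (pmul-comm g f)))

  pmul-0∷ : ∀ f g → pmul (0# ∷ f) g ≈ 0# ∷ pmul f g
  pmul-0∷ f g = padd-cong (scale-0 g) ≈-refl

  pmul-assoc : ∀ f g h → pmul (pmul f g) h ≈ pmul f (pmul g h)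
  pmul-assoc []      g h = ≈-refl
  pmul-assoc (a ∷ f) g h = ≈-trans (pmul-distribʳ h (scale a g) (0# ∷ pmul f g))
    (padd-cong (scale-pmul a g h)
      (≈-trans (pmul-0∷ (pmul f g) h) (∷-cong refl (pmul-assoc f g h))))

  pmul-identityˡ : ∀ f → pmul [ 1# ] f ≈ f
  pmul-identityˡ f = ≈-trans (padd-cong (scale-1 f) 0∷[]≈[]) (padd-identityʳ f)

  pneg : Poly → Poly
  pneg = scale (⊖ 1#)

  pneg-inverseʳ : ∀ f → padd f (pneg f) ≈ []
  pneg-inverseʳ f = ≈-trans (padd-cong (≈-sym (scale-1 f)) ≈-refl)
    (≈-trans (≈-sym (scale-⊕ 1# (⊖ 1#) f)) (≈-trans (scale-cong (K.-‿inverseʳ 1#) ≈-refl) (scale-0 f)))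

  -- Equal lengths leave no room for trailing zeros. This is the way back to `≡`, which `dividesᵇ`
  -- tests.
  ≡-by-length : ∀ {f g} → length f ≡ length g → f ≈ g → f ≡ g
  ≡-by-length {[]}    {[]}    _ _ = refl
  ≡-by-length {a ∷ f} {b ∷ g} l e = cong₂ _∷_ (at e 0) (≡-by-length (suc-injective l) (tail-cong e))

  coef-beyond : ∀ f n → length f ≤ n → coef f n ≡ 0#
  coef-beyond []      n       _ = refl
  coef-beyond (a ∷ f) (suc n) (s≤s h) = coef-beyond f n h

  length-padd : ∀ f g → length (padd f g) ≡ length f ⊔ length g
  length-padd []      g       = refl
  length-padd (a ∷ f) []      = refl
  length-padd (a ∷ f) (b ∷ g) = cong suc (length-padd f g)

  length-pmul : ∀ a f b g → length (pmul (a ∷ f) (b ∷ g)) ≡ length f + length (b ∷ g)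
  length-pmul a [] b g = cong suc (trans (length-padd (scale a g) []) (trans (⊔-identityʳ _) (length-map _ g)))
  length-pmul a (a′ ∷ f) b g = cong suc (trans (length-padd (scale a g) (pmul (a′ ∷ f) (b ∷ g)))
    (trans (cong₂ _⊔_ (length-map _ g) (length-pmul a′ f b g))
      (m≤n⇒m⊔n≡n (≤-trans (n≤1+n _) (m≤n+m _ (length f))))))

  truncate : (n : ℕ) → Poly → Vec Carrier n
  truncate zero    f       = []
  truncate (suc n) []      = 0# ∷ truncate n []
  truncate (suc n) (a ∷ f) = a ∷ truncate n f

  truncate-≈ : ∀ n f → (∀ k → n ≤ k → coef f k ≡ 0#) → toList (truncate n f) ≈ f
  truncate-≈ zero    f       h = pointwise λ k → sym (h k z≤n)
  truncate-≈ (suc n) []      h = 0∷-zero (truncate-≈ n [] (λ _ _ → refl))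
  truncate-≈ (suc n) (a ∷ f) h = ∷-cong refl (truncate-≈ n f (λ k n≤k → h (suc k) (s≤s n≤k)))

  truncate-coeffs : ∀ n f → coef f n ≡ 1# → (∀ k → n < k → coef f k ≡ 0#) → coeffs (n , truncate n f) ≈ f
  truncate-coeffs zero f h₁ h₂ = pointwise λ { zero → sym h₁ ; (suc k) → sym (h₂ (suc k) (s≤s z≤n)) }
  truncate-coeffs (suc n) [] h₁ h₂ = ⊥-elim (0≢1 h₁)
  truncate-coeffs (suc n) (a ∷ f) h₁ h₂ = ∷-cong refl (truncate-coeffs n f h₁ (λ k n<k → h₂ (suc k) (s≤s n<k)))

  length-coeffs : ∀ A → length (coeffs A) ≡ suc (deg A)
  length-coeffs (n , v) = trans (length-++ (toList v)) (trans (+-comm _ 1) (cong suc (length-toList v)))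

  lead : ∀ A → coef (coeffs A) (deg A) ≡ 1#
  lead (zero  , [])    = refl
  lead (suc n , a ∷ v) = lead (n , v)

  beyond : ∀ A k → deg A < k → coef (coeffs A) k ≡ 0#
  beyond A k h = coef-beyond (coeffs A) k (subst (_≤ k) (sym (length-coeffs A)) h)

  coeffs-injective : ∀ {A B} → coeffs A ≡ coeffs B → A ≡ B
  coeffs-injective {A} {B} e = go A B (suc-injective (trans (sym (length-coeffs A)) (trans (cong length e) (length-coeffs B)))) e
    where
    go : ∀ A B → deg A ≡ deg B → coeffs A ≡ coeffs B → A ≡ B
    go (zero  , [])    (_ , [])    refl _ = refl
    go (suc n , a ∷ v) (_ , b ∷ w) refl e with go (n , v) (n , w) refl (cong tail e) | cong (λ f → coef f 0) e
      where
      tail : Poly → Poly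
      tail []      = []
      tail (_ ∷ f) = f
    ... | refl | refl = refl

  -- If the degrees differed, the larger one would set a nonzero leading coefficient against 0; once
  -- they agree, the leading coefficients give c = 1.
  scaled-monic-injective : ∀ c A B → c ≢ 0# → scale c (coeffs A) ≈ coeffs B → A ≡ B
  scaled-monic-injective c A B c≢0 e with <-cmp (deg A) (deg B)
  ... | tri< lt _ _ = ⊥-elim (0≢1 (trans (sym (K.zeroʳ c)) (trans (cong (c ⊗_) (sym (beyond A (deg B) lt)))
          (trans (sym (coef-scale c (coeffs A) (deg B))) (trans (at e (deg B)) (lead B))))))
  ... | tri> _ _ gt = ⊥-elim (c≢0 (trans (sym (K.*-identityʳ c)) (trans (cong (c ⊗_) (sym (lead A)))
          (trans (sym (coef-scale c (coeffs A) (deg A))) (trans (at e (deg A)) (beyond B (deg A) gt))))))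
  ... | tri≈ _ eq _ = coeffs-injective (≡-by-length
          (trans (length-coeffs A) (trans (cong suc eq) (sym (length-coeffs B))))
          (≈-trans (≈-sym (scale-1 (coeffs A))) (≈-trans (scale-cong (sym c≡1) ≈-refl) e)))
    where
    c≡1 : c ≡ 1#
    c≡1 = trans (sym (K.*-identityʳ c)) (trans (cong (c ⊗_) (sym (lead A)))
      (trans (sym (coef-scale c (coeffs A) (deg A))) (trans (at e (deg A)) (trans (cong (coef (coeffs B)) eq) (lead B)))))

  coeffs-≈-injective : ∀ {A B} → coeffs A ≈ coeffs B → A ≡ B
  coeffs-≈-injective {A} {B} e = scaled-monic-injective 1# A B (0≢1 ∘ sym) (≈-trans (scale-1 (coeffs A)) e)

  scaled-monic≉0 : ∀ c A → c ≢ 0# → ¬ scale c (coeffs A) ≈ []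
  scaled-monic≉0 c A c≢0 e = c≢0 (trans (sym (K.*-identityʳ c)) (trans (cong (c ⊗_) (sym (lead A)))
    (trans (sym (coef-scale c (coeffs A) (deg A))) (at e (deg A)))))

  lead-pmul : ∀ A B → coef (pmul (coeffs A) (coeffs B)) (deg A + deg B) ≡ 1#
  lead-pmul (zero  , [])    B = trans (at (pmul-identityˡ (coeffs B)) (deg B)) (lead B)
  lead-pmul (suc n , a ∷ v) B = begin
    coef (padd (scale a (coeffs B)) (0# ∷ pmul f (coeffs B))) (suc k)
      ≡⟨ coef-padd (scale a (coeffs B)) _ (suc k) ⟩
    coef (scale a (coeffs B)) (suc k) ⊕ coef (pmul f (coeffs B)) k
      ≡⟨ cong₂ _⊕_ (trans (coef-scale a (coeffs B) (suc k))
           (trans (cong (a ⊗_) (beyond B (suc k) (s≤s (m≤n+m (deg B) n)))) (K.zeroʳ a)))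
           (lead-pmul (n , v) B) ⟩
    0# ⊕ 1#  ≡⟨ K.+-identityˡ 1# ⟩
    1#       ∎
    where
    open ≡-Reasoning
    f = coeffs (n , v)
    k = n + deg B

  length-pmul-coeffs : ∀ A B → length (pmul (coeffs A) (coeffs B)) ≡ suc (deg A + deg B)
  length-pmul-coeffs A B with coeffs A | length-coeffs A | coeffs B | length-coeffs B
  ... | a ∷ f | lf | b ∷ g | lg = trans (length-pmul a f b g)
          (trans (cong₂ _+_ (suc-injective lf) lg) (+-suc _ _))

  infixl 7 _·_
  -- Sealed so that products do not unfold into truncated vectors; only the degree and the
  -- coefficient list are visible.
  abstract
    _·_ : Monic → Monic → Monic
    A · B = deg A + deg B , truncate _ (pmul (coeffs A) (coeffs B))

    deg-· : ∀ A B → deg (A · B) ≡ deg A + deg B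
    deg-· A B = refl

    coeffs-· : ∀ A B → coeffs (A · B) ≡ pmul (coeffs A) (coeffs B)
    coeffs-· A B = ≡-by-length (trans (length-coeffs (A · B)) (sym (length-pmul-coeffs A B)))
      (truncate-coeffs _ (pmul (coeffs A) (coeffs B)) (lead-pmul A B)
        (λ k h → coef-beyond (pmul (coeffs A) (coeffs B)) k (subst (_≤ k) (sym (length-pmul-coeffs A B)) h)))

  coeffs-·≈ : ∀ A B → coeffs (A · B) ≈ pmul (coeffs A) (coeffs B)
  coeffs-·≈ A B = ≈-reflexive (coeffs-· A B)

  ·-comm : ∀ A B → A · B ≡ B · A
  ·-comm A B = coeffs-≈-injective (≈-trans (coeffs-·≈ A B)
    (≈-trans (pmul-comm (coeffs A) (coeffs B)) (≈-sym (coeffs-·≈ B A))))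

  ·-assoc : ∀ A B C → A · B · C ≡ A · (B · C)
  ·-assoc A B C = coeffs-≈-injective (≈-trans (coeffs-·≈ (A · B) C)
    (≈-trans (pmul-cong (coeffs-·≈ A B) ≈-refl) (≈-trans (pmul-assoc (coeffs A) (coeffs B) (coeffs C))
      (≈-trans (pmul-congʳ (coeffs A) (≈-sym (coeffs-·≈ B C))) (≈-sym (coeffs-·≈ A (B · C)))))))

  ·-identityˡ : ∀ A → one · A ≡ A
  ·-identityˡ A = coeffs-≈-injective (≈-trans (coeffs-·≈ one A) (pmul-identityˡ (coeffs A)))

  ·-identityʳ : ∀ A → A · one ≡ A
  ·-identityʳ A = trans (·-comm A one) (·-identityˡ A)

  deg0⇒one : ∀ A → deg A ≡ 0 → A ≡ one
  deg0⇒one (zero , []) _ = refl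

  inv-nonzero : ∀ c → c ≢ 0# → Σ Carrier λ d → d ⊗ c ≡ 1#
  inv-nonzero c c≢0 with inverse c c≢0
  ... | d , e = d , trans (K.*-comm d c) e

  -- Zero or a unit times a monic polynomial. The bound on deg R lets a remainder of short length
  -- serve as a smaller monic divisor in Euclid's algorithm.
  data Normalised (f : Poly) : Set where
    null   : f ≈ [] → Normalised f
    scaled : ∀ c R → c ≢ 0# → f ≈ scale c (coeffs R) → deg R < length f → Normalised f

  normalise : ∀ f → Normalised f
  normalise [] = null ≈-refl
  normalise (a ∷ f) with normalise f
  ... | scaled c (n , v) c≢0 e h with d , dc ← inv-nonzero c c≢0 =
        scaled c (suc n , (d ⊗ a) ∷ v) c≢0
          (∷-cong (trans (sym (K.*-identityˡ a)) (trans (cong (_⊗ a) (trans (sym dc) (K.*-comm d c))) (K.*-assoc c d a))) e)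
          (s≤s h)
  ... | null e with a ≟F 0#
  ...   | yes refl = null (0∷-zero e)
  ...   | no a≢0   = scaled a one a≢0 (∷-cong (sym (K.*-identityʳ a)) e) (s≤s z≤n)

  divMod : ∀ D f → ∃₂ λ Q R → f ≈ padd (pmul Q (coeffs D)) R × length R ≤ deg D
  divMod D [] = [] , [] , ≈-refl , z≤n
  divMod D (a ∷ f) with Q , R , e , l ← divMod D f =
    c ∷ Q , R′ , eq , ≤-reflexive (length-toList (truncate n S))
    where
    n = deg D
    d = coeffs D
    -- Once the tail is divided, the remainder a + T R has degree at most n, so subtracting c D once
    -- is enough.
    c = coef (a ∷ R) n
    S = padd (a ∷ R) (pneg (scale c d))
    R′ = toList (truncate n S)
    S-high : ∀ k → n ≤ k → coef S k ≡ 0#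
    S-high k n≤k with m≤n⇒m<n∨m≡n n≤k
    ... | inj₁ n<k = trans (coef-padd (a ∷ R) (pneg (scale c d)) k) (trans (cong₂ _⊕_ (coef-beyond (a ∷ R) k (≤-trans (s≤s l) n<k))
            (coef-beyond (pneg (scale c d)) k (subst (_≤ k) (sym (trans (length-map _ (scale c d)) (trans (length-map _ d) (length-coeffs D)))) n<k)))
            (K.+-identityˡ 0#))
    ... | inj₂ refl = trans (coef-padd (a ∷ R) (pneg (scale c d)) n) (trans (cong (c ⊕_)
            (trans (coef-scale (⊖ 1#) (scale c d) n) (cong (⊖ 1# ⊗_) (trans (coef-scale c d n)
              (trans (cong (c ⊗_) (lead D)) (K.*-identityʳ c))))))
            (trans (cong (_⊕ (⊖ 1# ⊗ c)) (sym (K.*-identityˡ c))) (trans (sym (K.distribʳ c 1# (⊖ 1#)))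
              (trans (cong (_⊗ c) (K.-‿inverseʳ 1#)) (K.zeroˡ c)))))
    open ≈-Reasoning
    eq : a ∷ f ≈ padd (pmul (c ∷ Q) d) R′
    eq = begin
      a ∷ f
        ≈⟨ ∷-cong (sym (K.+-identityˡ a)) e ⟩
      padd (0# ∷ pmul Q d) (a ∷ R)
        ≈⟨ padd-cong (≈-refl {0# ∷ pmul Q d}) (≈-sym (padd-identityʳ (a ∷ R))) ⟩
      padd (0# ∷ pmul Q d) (padd (a ∷ R) [])
        ≈⟨ padd-cong (≈-refl {0# ∷ pmul Q d}) (padd-cong (≈-refl {a ∷ R}) (≈-sym (≈-trans (padd-comm (pneg (scale c d)) (scale c d)) (pneg-inverseʳ (scale c d))))) ⟩
      padd (0# ∷ pmul Q d) (padd (a ∷ R) (padd (pneg (scale c d)) (scale c d)))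
        ≈⟨ padd-cong (≈-refl {0# ∷ pmul Q d}) (≈-sym (padd-assoc (a ∷ R) (pneg (scale c d)) (scale c d))) ⟩
      padd (0# ∷ pmul Q d) (padd S (scale c d))
        ≈⟨ padd-cong (≈-refl {0# ∷ pmul Q d}) (padd-comm S (scale c d)) ⟩
      padd (0# ∷ pmul Q d) (padd (scale c d) S)
        ≈⟨ ≈-trans (padd-swap (0# ∷ pmul Q d) (scale c d) S) (≈-sym (padd-assoc (scale c d) (0# ∷ pmul Q d) S)) ⟩
      padd (pmul (c ∷ Q) d) S
        ≈⟨ padd-cong (≈-refl {pmul (c ∷ Q) d}) (≈-sym (truncate-≈ n S S-high)) ⟩
      padd (pmul (c ∷ Q) d) R′ ∎

-- Boolean tests and finite lists

Reflects-map : ∀ {A B : Set} {b} → (A → B) → (B → A) → Reflects A b → Reflects B b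
Reflects-map f g (ofʸ a)  = ofʸ (f a)
Reflects-map f g (ofⁿ ¬a) = ofⁿ (¬a ∘ g)

isYes-reflects : ∀ {A : Set} (d : Dec A) → Reflects A ⌊ d ⌋
isYes-reflects (yes a) = ofʸ a
isYes-reflects (no ¬a) = ofⁿ ¬a

any-reflects : ∀ {A : Set} {P : A → Set} {p : A → Bool} → (∀ x → Reflects (P x) (p x)) →
               ∀ xs → Reflects (Any P xs) (any p xs)
any-reflects r []       = ofⁿ λ ()
any-reflects r (x ∷ xs) = Reflects-map
  (λ { (inj₁ px) → here px ; (inj₂ pxs) → there pxs }) (λ { (here px) → inj₁ px ; (there pxs) → inj₂ pxs })
  (r x ⊎-reflects any-reflects r xs)

all-reflects : ∀ {A : Set} {P : A → Set} {p : A → Bool} → (∀ x → Reflects (P x) (p x)) →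
               ∀ xs → Reflects (All P xs) (all p xs)
all-reflects r []       = ofʸ []
all-reflects r (x ∷ xs) = Reflects-map
  (λ { (px , pxs) → px ∷ pxs }) (λ { (px ∷ pxs) → px , pxs })
  (r x ×-reflects all-reflects r xs)

unique-↭ : ∀ {A : Set} {xs ys : List A} → Unique xs → Unique ys →
           (∀ {x} → x ∈ xs → x ∈ ys) → (∀ {x} → x ∈ ys → x ∈ xs) → xs ↭ ys
unique-↭ u u′ f g = ∼bag⇒↭ (unique∧set⇒bag u u′ (λ {x} → mk⇔ f g))

concatMap-map : ∀ {A B C : Set} (f : A → B → C) xs ys →
                concatMap (λ a → map (f a) ys) xs ≡ cartesianProductWith f xs ys
concatMap-map f []       ys = refl
concatMap-map f (x ∷ xs) ys = cong (map (f x) ys ++_) (concatMap-map f xs ys)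

sum-filter : ∀ {A : Set} {P : A → Set} (P? : ∀ x → Dec (P x)) (f : A → ℕ) xs →
             sum (map (λ x → if does (P? x) then f x else 0) xs) ≡ sum (map f (filter P? xs))
sum-filter P? f []       = refl
sum-filter P? f (x ∷ xs) with does (P? x)
... | true  = cong (f x +_) (sum-filter P? f xs)
... | false = sum-filter P? f xs

-- Divisibility and primes among monic polynomials

module Divisibility {q : ℕ} (𝔽 : FiniteField q) where
  open FiniteField 𝔽 renaming (_+_ to infixl 6 _⊕_; _*_ to infixl 7 _⊗_; -_ to infix 8 ⊖_; _≟_ to _≟F_)
  open FF 𝔽 renaming (∣_∣ to norm)
  open Polynomials 𝔽

  infix 4 _∣ᴾ_ _∣ᴹ_
  -- Differences and remainders need not be monic, so the ideal arguments take place among arbitrary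
  -- polynomials and return to `∣ᴹ` by normalising the quotient.
  record _∣ᴾ_ (P : Monic) (f : Poly) : Set where
    constructor _,_
    field
      quotient : Poly
      equation : pmul (coeffs P) quotient ≈ f

  record _∣ᴹ_ (D G : Monic) : Set where
    constructor _,_
    field
      cofactor : Monic
      equation : D · cofactor ≡ G

  ∣ᴾ-resp : ∀ P {f g} → f ≈ g → P ∣ᴾ f → P ∣ᴾ g
  ∣ᴾ-resp P e (E , h) = E , ≈-trans h e

  ∣ᴹ⇒∣ᴾ : ∀ {D G} → D ∣ᴹ G → D ∣ᴾ coeffs G
  ∣ᴹ⇒∣ᴾ {D} (E , refl) = coeffs E , ≈-sym (coeffs-·≈ D E)

  scale-· : ∀ c P R {E} → E ≈ scale c (coeffs R) → pmul (coeffs P) E ≈ scale c (coeffs (P · R))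
  scale-· c P R e = ≈-trans (pmul-congʳ (coeffs P) e)
    (≈-trans (pmul-scale c (coeffs P) (coeffs R)) (scale-cong refl (≈-sym (coeffs-·≈ P R))))

  ∣ᴾ⇒∣ᴹ : ∀ {D G} → D ∣ᴾ coeffs G → D ∣ᴹ G
  ∣ᴾ⇒∣ᴹ {D} {G} (E , h) with normalise E
  ... | null e = ⊥-elim (scaled-monic≉0 1# G (0≢1 ∘ sym) (≈-trans (scale-1 (coeffs G))
          (≈-trans (≈-sym h) (≈-trans (pmul-congʳ (coeffs D) e) (pmul-zeroʳ (coeffs D))))))
  ... | scaled c R c≢0 e _ = R , scaled-monic-injective c (D · R) G c≢0 (≈-trans (≈-sym (scale-· c D R e)) h)

  pmul-pneg : ∀ f g → pmul f (pneg g) ≈ pneg (pmul f g)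
  pmul-pneg = pmul-scale (⊖ 1#)

  padd-pneg-cancel : ∀ f g → padd (padd f (pneg g)) g ≈ f
  padd-pneg-cancel f g = ≈-trans (padd-assoc f (pneg g) g) (≈-trans (padd-cong (≈-refl {f})
    (≈-trans (padd-comm (pneg g) g) (pneg-inverseʳ g))) (padd-identityʳ f))

  subtract : ∀ {f g h} → f ≈ padd g h → padd f (pneg g) ≈ h
  subtract {f} {g} {h} e = ≈-trans (padd-cong (≈-trans e (padd-comm g h)) ≈-refl)
    (≈-trans (padd-assoc h g (pneg g)) (≈-trans (padd-cong (≈-refl {h}) (pneg-inverseʳ g)) (padd-identityʳ h)))

  ∣ᴾ-subtract : ∀ P {f g h} → f ≈ padd g h → P ∣ᴾ f → P ∣ᴾ g → P ∣ᴾ h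
  ∣ᴾ-subtract P e (E , hf) (E′ , hg) = padd E (pneg E′) ,
    ≈-trans (pmul-distribˡ (coeffs P) E (pneg E′))
      (≈-trans (padd-cong hf (≈-trans (pmul-pneg (coeffs P) E′) (scale-cong refl hg))) (subtract e))

  ∣ᴾ-pmul : ∀ P f {g} → P ∣ᴾ g → P ∣ᴾ pmul f g
  ∣ᴾ-pmul P f {g} (E , h) = pmul f E , ≈-trans (≈-sym (pmul-assoc (coeffs P) f E))
    (≈-trans (pmul-cong (pmul-comm (coeffs P) f) (≈-refl {E}))
      (≈-trans (pmul-assoc f (coeffs P) E) (pmul-congʳ f h)))

  ∣ᴾ-unscale : ∀ P c f → c ≢ 0# → P ∣ᴾ scale c f → P ∣ᴾ f
  ∣ᴾ-unscale P c f c≢0 (E , h) with d , dc ← inv-nonzero c c≢0 =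
    scale d E , ≈-trans (pmul-scale d (coeffs P) E) (≈-trans (scale-cong refl h)
      (≈-trans (scale-scale d c f) (≈-trans (scale-cong dc ≈-refl) (scale-1 f))))

  -- A nonzero difference is c R with R monic, and then P times it is c (P · R), again nonzero.
  ·-cancelˡ : ∀ P {A B} → P · A ≡ P · B → A ≡ B
  ·-cancelˡ P {A} {B} eq with normalise (padd (coeffs A) (pneg (coeffs B)))
  ... | null e = coeffs-≈-injective (≈-trans (≈-sym (padd-pneg-cancel (coeffs A) (coeffs B))) (padd-cong e ≈-refl))
  ... | scaled c R c≢0 e _ = ⊥-elim (scaled-monic≉0 c (P · R) c≢0 (≈-trans (≈-sym (scale-· c P R e))
          (≈-trans (pmul-distribˡ (coeffs P) (coeffs A) (pneg (coeffs B)))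
            (≈-trans (padd-cong (≈-sym (coeffs-·≈ P A)) (≈-trans (pmul-pneg (coeffs P) (coeffs B))
              (scale-cong refl (≈-trans (≈-sym (coeffs-·≈ P B)) (≈-reflexive (cong coeffs (sym eq)))))))
              (pneg-inverseʳ (coeffs (P · A)))))))

  ∣ᴹ⇒deg≤ : ∀ {D G} → D ∣ᴹ G → deg D ≤ deg G
  ∣ᴹ⇒deg≤ {D} (E , refl) = subst (deg D ≤_) (sym (deg-· D E)) (m≤m+n (deg D) (deg E))

  ∣ᴹ∧deg≡⇒≡ : ∀ {D G} → D ∣ᴹ G → deg D ≡ deg G → D ≡ G
  ∣ᴹ∧deg≡⇒≡ {D} (E , refl) eq = sym (trans (cong (D ·_) (deg0⇒one E
    (+-cancelˡ-≡ (deg D) _ _ (trans (sym (deg-· D E)) (trans (sym eq) (sym (+-identityʳ (deg D)))))))) (·-identityʳ D))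

  ∣ᴹ-refl : ∀ {D} → D ∣ᴹ D
  ∣ᴹ-refl {D} = one , ·-identityʳ D

  ∣ᴹ-trans : ∀ {A B C} → A ∣ᴹ B → B ∣ᴹ C → A ∣ᴹ C
  ∣ᴹ-trans {A} (E , refl) (E′ , refl) = E · E′ , sym (·-assoc A E E′)

  ∣ᴹ-·ʳ : ∀ {A B} C → A ∣ᴹ B → A ∣ᴹ C · B
  ∣ᴹ-·ʳ {A} {B} C h = ∣ᴹ-trans h (C , ·-comm B C)

  ∣ᴹ-·ˡ : ∀ {A B} C → A ∣ᴹ B → A ∣ᴹ B · C
  ∣ᴹ-·ˡ C h = ∣ᴹ-trans h (C , refl)

  IsPrime : Monic → Set
  IsPrime P = deg P ≢ 0 × (∀ D → D ∣ᴹ P → deg D ≡ 0 ⊎ deg D ≡ deg P)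

  -- One Euclidean step in the ideal of all X with P ∣ X B: the remainder of X by D is zero or, made
  -- monic, a member of smaller degree.
  reduce : ∀ P B D X → P ∣ᴾ pmul (coeffs D) (coeffs B) → P ∣ᴾ pmul (coeffs X) (coeffs B) →
           D ∣ᴹ X ⊎ ∃ λ R → deg R < deg D × P ∣ᴾ pmul (coeffs R) (coeffs B)
  reduce P B D X hD hX with divMod D (coeffs X)
  ... | Q , R , e , len with normalise R
  ...   | null r = inj₁ (∣ᴾ⇒∣ᴹ (Q , ≈-trans (pmul-comm (coeffs D) Q)
            (≈-trans (≈-sym (padd-identityʳ (pmul Q (coeffs D)))) (≈-trans (padd-cong ≈-refl (≈-sym r)) (≈-sym e)))))
  ...   | scaled c R′ c≢0 r lt = inj₂ (R′ , <-≤-trans lt len ,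
            ∣ᴾ-unscale P c (pmul (coeffs R′) b) c≢0
              (∣ᴾ-resp P (≈-trans (pmul-cong r (≈-refl {b})) (scale-pmul c (coeffs R′) b))
                (∣ᴾ-subtract P
                  (≈-trans (pmul-cong e (≈-refl {b})) (pmul-distribʳ b (pmul Q (coeffs D)) R))
                  hX (∣ᴾ-resp P (≈-sym (pmul-assoc Q (coeffs D) b)) (∣ᴾ-pmul P Q hD)))))
    where b = coeffs B

  -- The polynomials X with P ∣ X·B form an ideal containing P and A; its generator divides both.
  euclid : ∀ {P A B} → IsPrime P → P ∣ᴹ A · B → P ∣ᴹ A ⊎ P ∣ᴹ B
  euclid {P} {A} {B} (_ , irreducible) h = search (deg P) P ≤-refl PB
    where
    PB : P ∣ᴾ pmul (coeffs P) (coeffs B)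
    PB = coeffs B , ≈-refl
    AB : P ∣ᴾ pmul (coeffs A) (coeffs B)
    AB = ∣ᴾ-resp P (coeffs-·≈ A B) (∣ᴹ⇒∣ᴾ h)
    search : ∀ n D → deg D ≤ n → P ∣ᴾ pmul (coeffs D) (coeffs B) → P ∣ᴹ A ⊎ P ∣ᴹ B
    search n D D≤n hD with reduce P B D P hD PB
    search zero    D D≤n hD | inj₂ (R , lt , _)  = ⊥-elim (n≮0 (<-≤-trans lt D≤n))
    search (suc n) D D≤n hD | inj₂ (R , lt , hR) = search n R (s≤s⁻¹ (<-≤-trans lt D≤n)) hR
    search n D D≤n hD | inj₁ D∣P with reduce P B D A hD AB
    search zero    D D≤n hD | inj₁ D∣P | inj₂ (R , lt , _)  = ⊥-elim (n≮0 (<-≤-trans lt D≤n))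
    search (suc n) D D≤n hD | inj₁ D∣P | inj₂ (R , lt , hR) = search n R (s≤s⁻¹ (<-≤-trans lt D≤n)) hR
    ... | inj₁ D∣A with irreducible D D∣P
    ...   | inj₁ deg0 = inj₂ (∣ᴾ⇒∣ᴹ (∣ᴾ-resp P (≈-trans (≈-sym (coeffs-·≈ D B))
              (≈-reflexive (cong coeffs (trans (cong (_· B) (deg0⇒one D deg0)) (·-identityˡ B))))) hD))
    ...   | inj₂ eq = inj₁ (subst (_∣ᴹ A) (∣ᴹ∧deg≡⇒≡ D∣P eq) D∣A)

  infixr 8 _^ᴹ_
  _^ᴹ_ : Monic → ℕ → Monic
  P ^ᴹ zero  = one
  P ^ᴹ suc k = P · P ^ᴹ k

  ppow-coeffs : ∀ P k → ppow (coeffs P) k ≡ coeffs (P ^ᴹ k)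
  ppow-coeffs P zero    = refl
  ppow-coeffs P (suc k) = trans (cong (pmul (coeffs P)) (ppow-coeffs P k)) (sym (coeffs-· P (P ^ᴹ k)))

  ∈-elems : ∀ a → a ∈ elems
  ∈-elems a = subst (_∈ elems) (Inverse.strictlyInverseˡ enum a) (∈-map⁺ (Inverse.to enum) (∈-allFin _))

  vecs≡ : ∀ n → vecs (suc n) ≡ cartesianProductWith _∷_ elems (vecs n)
  vecs≡ n = concatMap-map _∷_ elems (vecs n)

  ∈-vecs : ∀ {n} (v : Vec Carrier n) → v ∈ vecs n
  ∈-vecs []      = here refl
  ∈-vecs {suc n} (a ∷ v) = subst (_ ∈_) (sym (vecs≡ n)) (∈-cartesianProductWith⁺ _∷_ (∈-elems a) (∈-vecs v))

  ∈-monicsUpTo⁺ : ∀ {n A} → deg A ≤ n → A ∈ monicsUpTo n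
  ∈-monicsUpTo⁺ {n} {A} h = ∈-concatMap⁺ monicsOfDeg (lose (∈-upTo⁺ (s≤s h)) (∈-map⁺ (deg A ,_) (∈-vecs (proj₂ A))))

  elems-unique : Unique elems
  elems-unique = UniqueP.map⁺ (λ {x} {y} e → trans (sym (Inverse.strictlyInverseʳ enum x))
    (trans (cong (Inverse.from enum) e) (Inverse.strictlyInverseʳ enum y))) (UniqueP.allFin⁺ q)

  vecs-unique : ∀ n → Unique (vecs n)
  vecs-unique zero    = [] AllPairs.∷ AllPairs.[]
  vecs-unique (suc n) = subst Unique (sym (vecs≡ n))
    (UniqueP.cartesianProductWith⁺ _∷_ (λ { refl → refl , refl }) elems-unique (vecs-unique n))

  monicsUpTo-unique : ∀ n → Unique (monicsUpTo n)
  monicsUpTo-unique n = UniqueP.concat⁺ {xss = map monicsOfDeg (upTo (suc n))}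
    (AllP.map⁺ (All.universal (λ k → UniqueP.map⁺ (λ { refl → refl }) (vecs-unique k)) (upTo (suc n))))
    (AllPairsP.map⁺ {f = monicsOfDeg} (AllPairs.map disjoint (UniqueP.upTo⁺ (suc n))))
    where
    disjoint : ∀ {i j} → i ≢ j → ∀ {A} → ¬ (A ∈ monicsOfDeg i × A ∈ monicsOfDeg j)
    disjoint {i} {j} i≢j (Ai , Aj) with ∈-map⁻ (i ,_) Ai | ∈-map⁻ (j ,_) Aj
    ... | _ , _ , refl | _ , _ , refl = i≢j refl

  dividesᵇ-reflects : ∀ D G → Reflects (D ∣ᴹ G) (dividesᵇ (coeffs D) G)
  dividesᵇ-reflects D G = Reflects-map to from
    (any-reflects (λ E → isYes-reflects (pmul (coeffs D) (coeffs E) ≟P coeffs G)) (monicsUpTo (deg G)))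
    where
    to : Any (λ E → pmul (coeffs D) (coeffs E) ≡ coeffs G) (monicsUpTo (deg G)) → D ∣ᴹ G
    to h with E , _ , e ← find h = E , coeffs-injective (trans (coeffs-· D E) e)
    from : D ∣ᴹ G → Any (λ E → pmul (coeffs D) (coeffs E) ≡ coeffs G) (monicsUpTo (deg G))
    from (E , refl) = lose (∈-monicsUpTo⁺ (subst (deg E ≤_) (sym (deg-· D E)) (m≤n+m (deg E) (deg D)))) (sym (coeffs-· D E))

  infix 4 _∣ᴹ?_
  -- Built with `because`, so that its `does` is the very boolean in the definitions of σ and φ;
  -- these sums and products then become filtered lists.
  _∣ᴹ?_ : ∀ D G → Dec (D ∣ᴹ G)
  D ∣ᴹ? G = dividesᵇ (coeffs D) G because dividesᵇ-reflects D G

  isPrimeᵇ-reflects : ∀ P → Reflects (IsPrime P) (isPrimeᵇ P)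
  isPrimeᵇ-reflects P = Reflects-map
    (λ { (d≢0 , h) → d≢0 , λ D D∣P → resolve (All.lookup h (∈-monicsUpTo⁺ (∣ᴹ⇒deg≤ D∣P))) D∣P })
    (λ { (d≢0 , h) → d≢0 , All.universal (λ D → unresolve (D ∣ᴹ? P) (h D)) (monicsUpTo (deg P)) })
    (¬-reflects (isYes-reflects (deg P ≟ 0)) ×-reflects
      all-reflects (λ D → ¬-reflects (dividesᵇ-reflects D P) ⊎-reflects
        (isYes-reflects (deg D ≟ 0) ⊎-reflects isYes-reflects (deg D ≟ deg P))) (monicsUpTo (deg P)))
    where
    resolve : ∀ {A B : Set} → ¬ A ⊎ B → A → B
    resolve (inj₁ ¬a) a = ⊥-elim (¬a a)
    resolve (inj₂ b)  _ = b
    unresolve : ∀ {A B : Set} → Dec A → (A → B) → ¬ A ⊎ B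
    unresolve (yes a) f = inj₂ (f a)
    unresolve (no ¬a) f = inj₁ ¬a

  isPrime? : ∀ P → Dec (IsPrime P)
  isPrime? P = isPrimeᵇ P because isPrimeᵇ-reflects P

  exists-prime-divisor : ∀ G → deg G ≢ 0 → ∃ λ P → IsPrime P × P ∣ᴹ G
  exists-prime-divisor G = search (deg G) G ≤-refl
    where
    search : ∀ n G → deg G ≤ n → deg G ≢ 0 → ∃ λ P → IsPrime P × P ∣ᴹ G
    search n G G≤n G≢0 with Any.any? (λ D → (D ∣ᴹ? G) ×-dec (¬? (deg D ≟ 0) ×-dec ¬? (deg D ≟ deg G))) (monicsUpTo (deg G))
    search zero    G G≤n G≢0 | yes _ = ⊥-elim (G≢0 (n≤0⇒n≡0 G≤n))
    search (suc n) G G≤n G≢0 | yes h with D , _ , D∣G , D≢0 , D≢G ← find h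
      with P , pp , P∣D ← search n D (s≤s⁻¹ (<-≤-trans (≤∧≢⇒< (∣ᴹ⇒deg≤ D∣G) D≢G) G≤n)) D≢0
      = P , pp , ∣ᴹ-trans P∣D D∣G
    ... | no none = G , (G≢0 , irreducible) , ∣ᴹ-refl
      where
      irreducible : ∀ D → D ∣ᴹ G → deg D ≡ 0 ⊎ deg D ≡ deg G
      irreducible D D∣G with deg D ≟ 0 | deg D ≟ deg G
      ... | yes e | _     = inj₁ e
      ... | no _  | yes e = inj₂ e
      ... | no ¬0 | no ¬G = ⊥-elim (none (lose (∈-monicsUpTo⁺ (∣ᴹ⇒deg≤ D∣G)) (D∣G , ¬0 , ¬G)))

  factor-out : ∀ {P} → IsPrime P → ∀ G → ∃₂ λ a H → G ≡ P ^ᴹ a · H × ¬ P ∣ᴹ H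
  factor-out {P} (P≢0 , _) G = search (deg G) G ≤-refl
    where
    search : ∀ n G → deg G ≤ n → ∃₂ λ a H → G ≡ P ^ᴹ a · H × ¬ P ∣ᴹ H
    search n G G≤n with P ∣ᴹ? G
    ... | no ¬d = 0 , G , sym (·-identityˡ G) , ¬d
    search zero    G G≤n | yes d = ⊥-elim (P≢0 (n≤0⇒n≡0 (≤-trans (∣ᴹ⇒deg≤ d) G≤n)))
    search (suc n) G G≤n | yes (E , refl)
      with a , H , eq , ¬d ← search n E (s≤s⁻¹ (<-≤-trans (m<n+m (deg E) (n≢0⇒n>0 P≢0)) (subst (_≤ suc n) (deg-· P E) G≤n)))
      = suc a , H , trans (cong (P ·_) eq) (sym (·-assoc P (P ^ᴹ a) H)) , ¬d

  abstract
    divisors : Monic → List Monic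
    divisors G = filter (_∣ᴹ? G) (monicsUpTo (deg G))

    ∈-divisors⁺ : ∀ {D G} → D ∣ᴹ G → D ∈ divisors G
    ∈-divisors⁺ {D} {G} h = ∈-filter⁺ (_∣ᴹ? G) (∈-monicsUpTo⁺ (∣ᴹ⇒deg≤ h)) h

    ∈-divisors⁻ : ∀ {D G} → D ∈ divisors G → D ∣ᴹ G
    ∈-divisors⁻ {D} {G} h = proj₂ (∈-filter⁻ (_∣ᴹ? G) {xs = monicsUpTo (deg G)} h)

    divisors-unique : ∀ G → Unique (divisors G)
    divisors-unique G = UniqueP.filter⁺ (_∣ᴹ? G) (monicsUpTo-unique (deg G))

    σ≡sum-divisors : ∀ G → σ G ≡ sum (map norm (divisors G))
    σ≡sum-divisors G = sum-filter (_∣ᴹ? G) norm (monicsUpTo (deg G))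

  ∣ᴹ-prime-cancel : ∀ {P D K} → IsPrime P → ¬ P ∣ᴹ D → D ∣ᴹ P · K → D ∣ᴹ K
  ∣ᴹ-prime-cancel {P} {D} {K} pp P∤D (E , eq) with euclid {A = D} {B = E} pp (K , sym eq)
  ... | inj₁ d = ⊥-elim (P∤D d)
  ... | inj₂ (E′ , refl) = E′ , ·-cancelˡ P (trans (trans (sym (·-assoc P D E′))
          (trans (cong (_· E′) (·-comm P D)) (·-assoc D P E′))) eq)

  ∣ᴹ-prime-power-cancel : ∀ {P D H} → IsPrime P → ¬ P ∣ᴹ D → ∀ a → D ∣ᴹ P ^ᴹ a · H → D ∣ᴹ H
  ∣ᴹ-prime-power-cancel {D = D} {H} pp P∤D zero h = subst (D ∣ᴹ_) (·-identityˡ H) h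
  ∣ᴹ-prime-power-cancel {P} {D} {H} pp P∤D (suc a) h = ∣ᴹ-prime-power-cancel pp P∤D a
    (∣ᴹ-prime-cancel pp P∤D (subst (D ∣ᴹ_) (·-assoc P (P ^ᴹ a) H) h))

  -- Split by whether P ∣ D: a divisor not divisible by P divides H by Euclid's lemma, and any other
  -- loses one factor P by cancellation.
  divisors-step : ∀ {P H} → IsPrime P → ¬ P ∣ᴹ H → ∀ a →
    divisors (P ^ᴹ suc a · H) ↭ divisors H ++ map (P ·_) (divisors (P ^ᴹ a · H))
  divisors-step {P} {H} pp P∤H a = unique-↭ (divisors-unique _)
    (UniqueP.++⁺ (divisors-unique H) (UniqueP.map⁺ (·-cancelˡ P) (divisors-unique K)) disjoint)
    to from
    where
    K = P ^ᴹ a · H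
    PK : P ^ᴹ suc a · H ≡ P · K
    PK = ·-assoc P (P ^ᴹ a) H
    disjoint : ∀ {D} → ¬ (D ∈ divisors H × D ∈ map (P ·_) (divisors K))
    disjoint (D∈ , D∈′) with E , _ , refl ← ∈-map⁻ (P ·_) D∈′ =
      P∤H (∣ᴹ-trans (E , refl) (∈-divisors⁻ D∈))
    to : ∀ {D} → D ∈ divisors (P ^ᴹ suc a · H) → D ∈ divisors H ++ map (P ·_) (divisors K)
    to {D} D∈ with P ∣ᴹ? D
    ... | no P∤D = ∈-++⁺ˡ (∈-divisors⁺ (∣ᴹ-prime-power-cancel pp P∤D (suc a) (∈-divisors⁻ D∈)))
    ... | yes (E , refl) with E′ , eq ← ∈-divisors⁻ D∈ =
          ∈-++⁺ʳ (divisors H) (∈-map⁺ (P ·_) (∈-divisors⁺ (E′ , ·-cancelˡ P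
            (trans (sym (·-assoc P E E′)) (trans eq PK)))))
    from : ∀ {D} → D ∈ divisors H ++ map (P ·_) (divisors K) → D ∈ divisors (P ^ᴹ suc a · H)
    from {D} D∈ with ∈-++⁻ (divisors H) D∈
    ... | inj₁ h = ∈-divisors⁺ (∣ᴹ-·ʳ (P ^ᴹ suc a) (∈-divisors⁻ h))
    ... | inj₂ h with E , E∈ , refl ← ∈-map⁻ (P ·_) h with E′ , eq ← ∈-divisors⁻ E∈ =
          ∈-divisors⁺ (E′ , trans (·-assoc P E E′) (trans (cong (P ·_) eq) (sym PK)))

product-filter : ∀ {A : Set} {P : A → Set} (P? : ∀ x → Dec (P x)) (f : A → ℕ) xs →
                 product (map (λ x → if does (P? x) then f x else 1) xs) ≡ product (map f (filter P? xs))
product-filter P? f []       = refl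
product-filter P? f (x ∷ xs) with does (P? x)
... | true  = cong (f x *_) (product-filter P? f xs)
... | false = trans (*-identityˡ _) (product-filter P? f xs)

∈⇒≤sum : ∀ {n ns} → n ∈ ns → n ≤ sum ns
∈⇒≤sum {ns = m ∷ ns} (here refl) = m≤m+n m (sum ns)
∈⇒≤sum {ns = m ∷ ns} (there h)   = ≤-trans (∈⇒≤sum h) (m≤n+m (sum ns) m)

-- The functions σ and φ

module Arithmetic {q : ℕ} (𝔽 : FiniteField q) where
  open FiniteField 𝔽 using (0#; 1#; 0≢1; enum; isCommutativeRing)
  open FF 𝔽 renaming (∣_∣ to norm)
  open Polynomials 𝔽
  open Divisibility 𝔽

  q>1 : 1 < q
  q>1 = two-elements (Inverse.from enum 0#) (Inverse.from enum 1#) λ e → 0≢1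
    (trans (sym (Inverse.strictlyInverseˡ enum 0#)) (trans (cong (Inverse.to enum) e) (Inverse.strictlyInverseˡ enum 1#)))
    where
    two-elements : ∀ {n} (i j : Fin n) → i ≢ j → 1 < n
    two-elements {suc zero} Fin.zero Fin.zero i≢j = ⊥-elim (i≢j refl)
    two-elements {suc (suc n)} _ _ _ = s≤s (s≤s z≤n)

  instance
    q-nonZero : NonZero q
    q-nonZero = >-nonZero (<-trans (s≤s z≤n) q>1)

  norm-· : ∀ A B → norm (A · B) ≡ norm A * norm B
  norm-· A B = trans (cong (q ^_) (deg-· A B)) (^-distribˡ-+-* q (deg A) (deg B))

  sum-norm-· : ∀ P Ds → sum (map norm (map (P ·_) Ds)) ≡ norm P * sum (map norm Ds)
  sum-norm-· P []       = sym (*-zeroʳ (norm P))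
  sum-norm-· P (D ∷ Ds) = trans (cong₂ _+_ (norm-· P D) (sum-norm-· P Ds))
                                (sym (*-distribˡ-+ (norm P) (norm D) _))

  σ-step : ∀ {P H} → IsPrime P → ¬ P ∣ᴹ H → ∀ a →
           σ (P ^ᴹ suc a · H) ≡ σ H + norm P * σ (P ^ᴹ a · H)
  σ-step {P} {H} pp P∤H a = begin
    σ (P ^ᴹ suc a · H)                              ≡⟨ σ≡sum-divisors _ ⟩
    sum (map norm (divisors (P ^ᴹ suc a · H)))      ≡⟨ sum-↭ (Perm.map⁺ norm (divisors-step pp P∤H a)) ⟩
    sum (map norm (divisors H ++ map (P ·_) Ds))    ≡⟨ cong sum (map-++ norm (divisors H) _) ⟩
    sum (map norm (divisors H) ++ map norm (map (P ·_) Ds))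
      ≡⟨ sum-++ (map norm (divisors H)) _ ⟩
    sum (map norm (divisors H)) + sum (map norm (map (P ·_) Ds))
      ≡⟨ cong₂ _+_ (sym (σ≡sum-divisors H)) (trans (sum-norm-· P Ds) (cong (norm P *_) (sym (σ≡sum-divisors _)))) ⟩
    σ H + norm P * σ (P ^ᴹ a · H)                   ∎
    where
    open ≡-Reasoning
    Ds = divisors (P ^ᴹ a · H)

  -- `σ-step` adds σ(H) and multiplies by the norm of P, which is the Horner recursion of `geo`.
  σ-prime-power : ∀ {P H} → IsPrime P → ¬ P ∣ᴹ H → ∀ a → σ (P ^ᴹ a · H) ≡ geo (norm P) (suc a) * σ H
  σ-prime-power {P} {H} pp P∤H zero = trans (cong σ (·-identityˡ H))
    (sym (trans (cong (λ x → suc x * σ H) (*-zeroʳ (norm P))) (*-identityˡ (σ H))))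
  σ-prime-power {P} {H} pp P∤H (suc a) = trans (σ-step pp P∤H a)
    (cong (σ H +_) (trans (cong (norm P *_) (σ-prime-power pp P∤H a)) (sym (*-assoc (norm P) _ (σ H)))))

  one∣ : ∀ G → one ∣ᴹ G
  one∣ G = G , ·-identityˡ G

  σ-one : σ one ≡ 1
  σ-one with dividesᵇ (coeffs one) one | dividesᵇ-reflects one one
  ... | true  | _ = refl
  ... | false | ofⁿ ¬d = ⊥-elim (¬d (one∣ one))

  prime∤one : ∀ {P} → IsPrime P → ¬ P ∣ᴹ one
  prime∤one (P≢0 , _) d = P≢0 (n≤0⇒n≡0 (∣ᴹ⇒deg≤ d))

  σ-prime-power-one : ∀ {P} → IsPrime P → ∀ a → σ (P ^ᴹ a · one) ≡ geo (norm P) (suc a)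
  σ-prime-power-one {P} pp a = trans (σ-prime-power pp (prime∤one pp) a)
    (trans (cong (geo (norm P) (suc a) *_) σ-one) (*-identityʳ _))

  cofactor-deg< : ∀ {P} → IsPrime P → ∀ a H → deg H < deg (P ^ᴹ suc a · H)
  cofactor-deg< {P} (P≢0 , _) a H = subst (deg H <_) (sym (deg-· (P ^ᴹ suc a) H)) (m<n+m (deg H)
    (<-≤-trans (n≢0⇒n>0 P≢0) (∣ᴹ⇒deg≤ (∣ᴹ-·ˡ (P ^ᴹ a) (∣ᴹ-refl {P})))))

  -- A prime P of G contributes the pair of deg P and v_P(G) + 1, the number of terms of its
  -- geometric sum. Nothing else enters σ, so the primes themselves are forgotten.
  σ-factorisation : ∀ G → ∃ λ (L : List (ℕ × ℕ)) → All (λ em → 0 < proj₁ em × 0 < proj₂ em) L ×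
                    σ G ≡ product (map (λ em → geo (q ^ proj₁ em) (proj₂ em)) L)
  σ-factorisation G = search (deg G) G ≤-refl
    where
    search : ∀ n G → deg G ≤ n → ∃ λ (L : List (ℕ × ℕ)) → All (λ em → 0 < proj₁ em × 0 < proj₂ em) L ×
             σ G ≡ product (map (λ em → geo (q ^ proj₁ em) (proj₂ em)) L)
    search n G G≤n with deg G ≟ 0
    ... | yes G0 = [] , [] , trans (cong σ (deg0⇒one G G0)) σ-one
    search zero    G G≤n | no G≢0 = ⊥-elim (G≢0 (n≤0⇒n≡0 G≤n))
    search (suc n) G G≤n | no G≢0
      with P , pp , P∣G ← exists-prime-divisor G G≢0
      with factor-out pp G
    ... | zero  , H , refl , P∤H = ⊥-elim (P∤H (subst (P ∣ᴹ_) (·-identityˡ H) P∣G))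
    ... | suc a , H , refl , P∤H
      with L , L>0 , eq ← search n H (s≤s⁻¹ (<-≤-trans (cofactor-deg< pp a H) G≤n))
      = (deg P , suc (suc a)) ∷ L , (n≢0⇒n>0 (proj₁ pp) , s≤s z≤n) ∷ L>0
      , trans (σ-prime-power pp P∤H (suc a)) (cong (geo (norm P) (suc (suc a)) *_) eq)

  norm≤σ : ∀ G → norm G ≤ σ G
  norm≤σ G = subst (norm G ≤_) (sym (σ≡sum-divisors G)) (∈⇒≤sum (∈-map⁺ norm (∈-divisors⁺ (∣ᴹ-refl {G}))))

  norm≤1⇒one : ∀ G → norm G ≤ 1 → G ≡ one
  norm≤1⇒one (zero  , [])    _ = refl
  norm≤1⇒one (suc n , a ∷ v) h = ⊥-elim (<⇒≱ (<-≤-trans q>1 (m≤m*n q (q ^ n) {{m^n≢0 q n}})) h)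

  φ-factor : Monic → Monic → ℕ
  φ-factor F P = norm P ^ (v P F ∸ 1) * (norm P ∸ 1)

  abstract
    primeDivisors : Monic → List Monic
    primeDivisors F = filter (λ P → isPrime? P ×-dec (P ∣ᴹ? F)) (monicsUpTo (deg F))

    ∈-primeDivisors⁺ : ∀ {P F} → IsPrime P → P ∣ᴹ F → P ∈ primeDivisors F
    ∈-primeDivisors⁺ {P} {F} pp h =
      ∈-filter⁺ (λ P → isPrime? P ×-dec (P ∣ᴹ? F)) (∈-monicsUpTo⁺ (∣ᴹ⇒deg≤ h)) (pp , h)

    ∈-primeDivisors⁻ : ∀ {P F} → P ∈ primeDivisors F → IsPrime P × P ∣ᴹ F
    ∈-primeDivisors⁻ {P} {F} h =
      proj₂ (∈-filter⁻ (λ P → isPrime? P ×-dec (P ∣ᴹ? F)) {xs = monicsUpTo (deg F)} h)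

    primeDivisors-unique : ∀ F → Unique (primeDivisors F)
    primeDivisors-unique F = UniqueP.filter⁺ (λ P → isPrime? P ×-dec (P ∣ᴹ? F)) (monicsUpTo-unique (deg F))

    φ≡product : ∀ F → φ F ≡ product (map (φ-factor F) (primeDivisors F))
    φ≡product F = product-filter (λ P → isPrime? P ×-dec (P ∣ᴹ? F)) (φ-factor F) (monicsUpTo (deg F))

  -- A repeated prime contributes a positive power of its norm, hence a factor q. Otherwise only the
  -- degrees of the primes are kept.
  φ-dichotomy : ∀ F → q ∣ φ F ⊎ ∃ λ ds → All (0 <_) ds × φ F ≡ product (map (λ d → q ^ d ∸ 1) ds)
  φ-dichotomy F with scan (primeDivisors F) (All.tabulate λ P∈ → n≢0⇒n>0 (proj₁ (proj₁ (∈-primeDivisors⁻ P∈))))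
    where
    scan : ∀ Ps → All (λ P → 0 < deg P) Ps → q ∣ product (map (φ-factor F) Ps) ⊎
           ∃ λ ds → All (0 <_) ds × product (map (φ-factor F) Ps) ≡ product (map (λ d → q ^ d ∸ 1) ds)
    scan [] [] = inj₂ ([] , [] , refl)
    scan (P ∷ Ps) (P>0 ∷ Ps>0) with scan Ps Ps>0
    ... | inj₁ d = inj₁ (∣n⇒∣m*n (φ-factor F P) d)
    ... | inj₂ (ds , ds>0 , eq) with v P F ∸ 1
    ...   | zero  = inj₂ (deg P ∷ ds , P>0 ∷ ds>0 , cong₂ _*_ (*-identityˡ (norm P ∸ 1)) eq)
    ...   | suc k = inj₁ (∣m⇒∣m*n (product (map (φ-factor F) Ps)) (∣m⇒∣m*n (norm P ∸ 1) (∣m⇒∣m*n (norm P ^ k)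
              (∣power (deg P) P>0 (divides 1 (sym (*-identityˡ q)))))))
  ... | inj₁ d = inj₁ (subst (q ∣_) (sym (φ≡product F)) d)
  ... | inj₂ (ds , ds>0 , eq) = inj₂ (ds , ds>0 , trans (φ≡product F) eq)

  -- Any prime P of F gives a divisor |P| - 1 ≥ q - 1 ≥ 2 of φ(F). For q = 2 this fails: φ(T) = 1.
  φ≡1⇒one : 2 < q → ∀ F → φ F ≡ 1 → F ≡ one
  φ≡1⇒one q>2 F eq with deg F ≟ 0
  ... | yes F0 = deg0⇒one F F0
  ... | no F≢0 with P , pp , P∣F ← exists-prime-divisor F F≢0 = ⊥-elim (<⇒≢ norm-1>1 (sym (∣1⇒≡1 norm-1∣1)))
    where
    norm-1∣1 : norm P ∸ 1 ∣ 1
    norm-1∣1 = subst (norm P ∸ 1 ∣_) (trans (sym (φ≡product F)) eq)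
      (∣-trans (n∣m*n (norm P ^ (v P F ∸ 1))) (∈⇒∣product (∈-map⁺ (φ-factor F) (∈-primeDivisors⁺ pp P∣F))))
    norm-1>1 : 1 < norm P ∸ 1
    norm-1>1 = ∸-monoˡ-≤ 1 (≤-trans q>2 (subst (_≤ norm P) (*-identityʳ q)
      (^-monoʳ-≤ q (n≢0⇒n>0 (proj₁ pp)))))

  v≤1 : ∀ P F → ¬ P ^ᴹ 2 ∣ᴹ F → v P F ∸ 1 ≡ 0
  v≤1 P F P²∤F = m≤n⇒m∸n≡0 (bound (upTo (suc (deg F))))
    where
    bound : ∀ ks → foldr (λ k acc → if dividesᵇ (ppow (coeffs P) k) F then k ⊔ acc else acc) 0 ks ≤ 1
    bound [] = z≤n
    bound (k ∷ ks) rewrite ppow-coeffs P k with dividesᵇ (coeffs (P ^ᴹ k)) F | dividesᵇ-reflects (P ^ᴹ k) F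
    ... | false | _ = bound ks
    ... | true  | ofʸ d = ⊔-lub (k≤1 k d) (bound ks)
      where
      k≤1 : ∀ k → P ^ᴹ k ∣ᴹ F → k ≤ 1
      k≤1 zero _ = z≤n
      k≤1 (suc zero) _ = s≤s z≤n
      k≤1 (suc (suc k)) d = ⊥-elim (P²∤F (∣ᴹ-trans (P ^ᴹ k ,
        trans (cong (λ X → P · X · P ^ᴹ k) (·-identityʳ P)) (·-assoc P P (P ^ᴹ k))) d))

  φ-squarefree : ∀ F Ps → Unique Ps → (∀ {P} → P ∈ Ps → IsPrime P × P ∣ᴹ F × ¬ P ^ᴹ 2 ∣ᴹ F) →
                 (∀ {P} → IsPrime P → P ∣ᴹ F → P ∈ Ps) → φ F ≡ product (map (λ P → norm P ∸ 1) Ps)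
  φ-squarefree F Ps u h⁺ h⁻ = trans (φ≡product F) (trans
    (product-↭ (Perm.map⁺ (φ-factor F) (unique-↭ (primeDivisors-unique F) u
      (λ P∈ → uncurry h⁻ (∈-primeDivisors⁻ P∈))
      (λ P∈ → ∈-primeDivisors⁺ (proj₁ (h⁺ P∈)) (proj₁ (proj₂ (h⁺ P∈)))))))
    (simplify Ps (All.tabulate λ P∈ → proj₂ (proj₂ (h⁺ P∈)))))
    where
    simplify : ∀ Ps → All (λ P → ¬ P ^ᴹ 2 ∣ᴹ F) Ps →
               product (map (φ-factor F) Ps) ≡ product (map (λ P → norm P ∸ 1) Ps)
    simplify [] [] = refl
    simplify (P ∷ Ps) (¬d ∷ ¬ds) = cong₂ _*_
      (trans (cong (λ k → norm P ^ k * (norm P ∸ 1)) (v≤1 P F ¬d)) (*-identityˡ (norm P ∸ 1)))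
      (simplify Ps ¬ds)

  prime∣prime⇒≡ : ∀ {P Q} → IsPrime P → IsPrime Q → P ∣ᴹ Q → P ≡ Q
  prime∣prime⇒≡ {P} (P≢0 , _) (_ , irr) d with irr P d
  ... | inj₁ e = ⊥-elim (P≢0 e)
  ... | inj₂ e = ∣ᴹ∧deg≡⇒≡ d e

  square∤prime· : ∀ {P Q} → IsPrime P → ¬ P ∣ᴹ Q → ¬ P ^ᴹ 2 ∣ᴹ P · Q
  square∤prime· {P} {Q} pp P∤Q (E , eq) = P∤Q (E , ·-cancelˡ P
    (trans (sym (·-assoc P P E)) (trans (cong (λ X → P · X · E) (sym (·-identityʳ P))) eq)))

  φ-prime : ∀ {P} → IsPrime P → φ P ≡ norm P ∸ 1
  φ-prime {P} pp = trans (φ-squarefree P (P ∷ []) ([] AllPairs.∷ AllPairs.[])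
    (λ { (here refl) → pp , ∣ᴹ-refl , λ d → square∤prime· pp (prime∤one pp) (subst (P ^ᴹ 2 ∣ᴹ_) (sym (·-identityʳ P)) d) })
    (λ pp′ d → here (prime∣prime⇒≡ pp′ pp d)))
    (*-identityʳ (norm P ∸ 1))

  φ-two-primes : ∀ {P Q} → IsPrime P → IsPrime Q → P ≢ Q → φ (P · Q) ≡ (norm P ∸ 1) * (norm Q ∸ 1)
  φ-two-primes {P} {Q} pp qp P≢Q = trans
    (φ-squarefree (P · Q) (P ∷ Q ∷ []) ((P≢Q ∷ []) AllPairs.∷ ([] AllPairs.∷ AllPairs.[]))
      (λ { (here refl) → pp , ∣ᴹ-·ˡ Q ∣ᴹ-refl , square∤prime· pp (λ d → P≢Q (prime∣prime⇒≡ pp qp d))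
         ; (there (here refl)) → qp , ∣ᴹ-·ʳ P ∣ᴹ-refl , λ d →
             square∤prime· qp (λ d → P≢Q (sym (prime∣prime⇒≡ qp pp d))) (subst (Q ^ᴹ 2 ∣ᴹ_) (·-comm P Q) d) })
      cover)
    (cong ((norm P ∸ 1) *_) (*-identityʳ (norm Q ∸ 1)))
    where
    cover : ∀ {R} → IsPrime R → R ∣ᴹ P · Q → R ∈ P ∷ Q ∷ []
    cover rp d with euclid rp d
    ... | inj₁ e = here (prime∣prime⇒≡ rp pp e)
    ... | inj₂ e = there (here (prime∣prime⇒≡ rp qp e))

  linear-prime : ∀ {P} → deg P ≡ 1 → IsPrime P
  linear-prime {P} eq = (λ e → 1+n≢0 (trans (sym eq) e)) , λ D D∣P → go D (subst (deg D ≤_) eq (∣ᴹ⇒deg≤ D∣P))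
    where
    go : ∀ D → deg D ≤ 1 → deg D ≡ 0 ⊎ deg D ≡ deg P
    go (zero , _) _ = inj₁ refl
    go (suc zero , _) _ = inj₂ (sym eq)
    go (suc (suc _) , _) (s≤s ())

  T T+1 : Monic
  T   = 1 , 0# ∷ []
  T+1 = 1 , 1# ∷ []

  T-prime : IsPrime T
  T-prime = linear-prime refl

  T∤T+1 : ¬ T ∣ᴹ T+1
  T∤T+1 d with ∣ᴹ∧deg≡⇒≡ d refl
  ... | eq = 0≢1 (cong (λ A → coef (coeffs A) 0) eq)

  productᴹ : List Monic → Monic
  productᴹ = foldr _·_ one

  ∈⇒∣productᴹ : ∀ {A As} → A ∈ As → A ∣ᴹ productᴹ As
  ∈⇒∣productᴹ {As = A ∷ As} (here refl) = productᴹ As , refl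
  ∈⇒∣productᴹ {As = A ∷ As} (there h)   = ∣ᴹ-·ʳ A (∈⇒∣productᴹ h)

  successor : ∀ Z → deg Z ≢ 0 → ∃ λ W → deg W ≢ 0 × coeffs W ≡ padd (coeffs one) (coeffs Z)
  successor (zero , _) Z≢0 = ⊥-elim (Z≢0 refl)
  successor (suc n , a ∷ z) _ = (suc n , FiniteField._+_ 𝔽 1# a ∷ z) , (λ ()) , refl

  -- Euclid's argument: a prime of degree at most B dividing 1 + T · ∏, with ∏ over all monic
  -- polynomials of degree at most B, would divide 1. The factor T keeps the degree positive even if
  -- B = 0.
  large-prime : ∀ B → ∃ λ P → IsPrime P × B < deg P
  large-prime B
    with W , W≢0 , Weq ← successor (T · productᴹ (monicsUpTo B))
           (λ e → 1+n≢0 (trans (sym (deg-· T _)) e))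
    with P , pp , P∣W ← exists-prime-divisor W W≢0
    with B <? deg P
  ... | yes B<P = P , pp , B<P
  ... | no B≮P  = ⊥-elim (prime∤one pp (∣ᴾ⇒∣ᴹ (∣ᴾ-subtract P
          (≈-trans (≈-reflexive Weq) (padd-comm (coeffs one) _)) (∣ᴹ⇒∣ᴾ P∣W)
          (∣ᴹ⇒∣ᴾ (∣ᴹ-·ʳ T (∈⇒∣productᴹ (∈-monicsUpTo⁺ (≮⇒≥ B≮P))))))))

-- The case q > 3

module Finiteness {r : ℕ} (𝔽 : FiniteField (suc r)) (3≤r : 3 ≤ r) where
  open FF 𝔽 renaming (∣_∣ to norm)
  open Arithmetic 𝔽
  open PowersMinusOne r

  Factor : ℕ × ℕ → ℕ
  Factor em = geo (q ^ proj₁ em) (proj₂ em)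

  -- Each factor is (q^(e m) - 1)/(q^e - 1); the denominators are moved to the other side.
  product-telescope : ∀ L → product (map Factor L) * product (map pw (map proj₁ L))
                          ≡ product (map pw (map (uncurry _*_) L))
  product-telescope [] = refl
  product-telescope ((e , m) ∷ L) = begin
    geo (q ^ e) m * X * (pw e * Y)                ≡⟨ cong (λ x → geo x m * X * (pw e * Y)) (suc-pw e) ⟩
    geo (suc (pw e)) m * X * (pw e * Y)           ≡⟨ lem (geo (suc (pw e)) m) X (pw e) Y ⟩
    pw e * geo (suc (pw e)) m * (X * Y)           ≡⟨ cong₂ _*_ (sym (pw-* e m)) (product-telescope L) ⟩
    pw (e * m) * product (map pw (map (uncurry _*_) L)) ∎
    where
    open ≡-Reasoning
    X = product (map Factor L)
    Y = product (map pw (map proj₁ L))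
    lem : ∀ g x p y → g * x * (p * y) ≡ p * g * (x * y)
    lem = solve-∀

  product≡1[mod-q] : ∀ L → All (λ em → 0 < proj₁ em × 0 < proj₂ em) L → ∃ λ t → product (map Factor L) ≡ 1 + q * t
  product≡1[mod-q] [] [] = 0 , sym (cong suc (*-zeroʳ q))
  product≡1[mod-q] ((suc e , suc m) ∷ L) (_ ∷ L>0) with t , eq ← product≡1[mod-q] L L>0 =
    _ , trans (cong (geo (q ^ suc e) (suc m) *_) eq) (lem q (q ^ e) (geo (q ^ suc e) m) t)
    where
    lem : ∀ q x g t → (1 + q * x * g) * (1 + q * t) ≡ 1 + q * (x * g + t + q * x * g * t)
    lem = solve-∀

  φ≡σ⇒one : ∀ F G → φ F ≡ σ G → F ≡ one × G ≡ one
  φ≡σ⇒one F G eq with L , L>0 , σ≡ ← σ-factorisation G with φ-dichotomy F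
  ... | inj₁ q∣φ with t , ≡1 ← product≡1[mod-q] L L>0 =
        ⊥-elim (<⇒≢ q>1 (sym (∣1⇒≡1 (∣m+n∣m⇒∣n
          (subst (q ∣_) (trans eq (trans σ≡ (trans ≡1 (+-comm 1 (q * t))))) q∣φ) (m∣m*n t)))))
  -- An empty product means φ(F) = 1, and then |G| ≤ σ(G) = 1 disposes of G as well.
  ... | inj₂ ([] , _ , φ≡) = φ≡1⇒one (≤-trans (s≤s (s≤s (s≤s z≤n))) (s≤s 3≤r)) F φ≡
          , norm≤1⇒one G (≤-trans (norm≤σ G) (≤-reflexive (trans (sym eq) φ≡)))
  ... | inj₂ (ds@(_ ∷ _) , ds>0 , φ≡) = ⊥-elim (<⇒≢ (m<n+m (length L) (s≤s z≤n)) (sym lengths))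
    where
    open ≡-Reasoning
    products : product (map pw (ds ++ map proj₁ L)) ≡ product (map pw (map (uncurry _*_) L))
    products = begin
      product (map pw (ds ++ map proj₁ L))                      ≡⟨ cong product (map-++ pw ds (map proj₁ L)) ⟩
      product (map pw ds ++ map pw (map proj₁ L))               ≡⟨ product-++ (map pw ds) _ ⟩
      product (map pw ds) * product (map pw (map proj₁ L))      ≡⟨ cong (_* product (map pw (map proj₁ L))) (trans (sym φ≡) (trans eq σ≡)) ⟩
      product (map Factor L) * product (map pw (map proj₁ L))   ≡⟨ product-telescope L ⟩
      product (map pw (map (uncurry _*_) L))                    ∎
    lengths : length ds + length L ≡ length L
    lengths = begin
      length ds + length L                  ≡⟨ cong (length ds +_) (sym (length-map proj₁ L)) ⟩
      length ds + length (map proj₁ L)      ≡⟨ sym (length-++ ds) ⟩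
      length (ds ++ map proj₁ L)            ≡⟨ equal-products⇒equal-lengths r 3≤r _ _
                                                 (AllP.++⁺ ds>0 (AllP.map⁺ (All.map proj₁ L>0)))
                                                 (AllP.map⁺ (All.map (λ { (e>0 , m>0) → *-mono-≤ e>0 m>0 }) L>0))
                                                 products ⟩
      length (map (uncurry _*_) L)          ≡⟨ length-map (uncurry _*_) L ⟩
      length L                              ∎

-- The cases q = 2 and q = 3

geo-identity₂ : ∀ {q} → q ≡ 2 → ∀ n → q ^ suc n ∸ 1 ≡ geo (q ^ 1) (suc n)
geo-identity₂ refl n = trans (cong pred (pow≡1+geo 1 (suc n))) (*-identityˡ (geo 2 (suc n)))

-- It rests on (q - 1)² = 4 = q + 1 for q = 3, the right-hand side being σ(T + 1).
geo-identity₃ : ∀ {q} → q ≡ 3 → ∀ n → (q ^ 1 ∸ 1) * (q ^ suc n ∸ 1) ≡ geo (q ^ 1) (suc n) * geo (q ^ 1) 2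
geo-identity₃ refl n = trans (cong (λ x → 2 * pred x) (pow≡1+geo 2 (suc n))) (lem (geo 3 (suc n)))
  where
  lem : ∀ g → 2 * (2 * g) ≡ g * 4
  lem = solve-∀

module Infinitude {q : ℕ} (𝔽 : FiniteField q) where
  open FF 𝔽 renaming (∣_∣ to norm)
  open Polynomials 𝔽
  open Divisibility 𝔽
  open Arithmetic 𝔽

  pair₂ : q ≡ 2 → ∀ P → IsPrime P → φ P ≡ σ (T ^ᴹ (deg P ∸ 1) · one)
  pair₂ q≡2 (zero , _) (P≢0 , _) = ⊥-elim (P≢0 refl)
  pair₂ q≡2 P@(suc n , _) pp = begin
    φ P                                   ≡⟨ φ-prime pp ⟩
    q ^ suc n ∸ 1                         ≡⟨ geo-identity₂ q≡2 n ⟩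
    geo (q ^ 1) (suc n)                   ≡⟨ sym (σ-prime-power-one T-prime n) ⟩
    σ (T ^ᴹ n · one)                      ∎
    where open ≡-Reasoning

  pair₃ : q ≡ 3 → ∀ P → IsPrime P → 1 < deg P → φ (T · P) ≡ σ (T ^ᴹ (deg P ∸ 1) · (T+1 ^ᴹ 1 · one))
  pair₃ q≡3 (zero , _) (P≢0 , _) _ = ⊥-elim (P≢0 refl)
  pair₃ q≡3 P@(suc n , _) pp P>1 = begin
    φ (T · P)                             ≡⟨ φ-two-primes T-prime pp (λ e → <⇒≢ P>1 (cong deg e)) ⟩
    (q ^ 1 ∸ 1) * (q ^ suc n ∸ 1)         ≡⟨ geo-identity₃ q≡3 n ⟩
    geo (q ^ 1) (suc n) * geo (q ^ 1) 2
      ≡⟨ cong (geo (q ^ 1) (suc n) *_) (sym (σ-prime-power-one {T+1} (linear-prime refl) 1)) ⟩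
    geo (q ^ 1) (suc n) * σ (T+1 ^ᴹ 1 · one)
      ≡⟨ sym (σ-prime-power T-prime T∤ n) ⟩
    σ (T ^ᴹ n · (T+1 ^ᴹ 1 · one))         ∎
    where
    open ≡-Reasoning
    T∤ : ¬ T ∣ᴹ T+1 ^ᴹ 1 · one
    T∤ d = T∤T+1 (subst (T ∣ᴹ_) (trans (·-identityʳ (T+1 · one)) (·-identityʳ T+1)) d)

  pair : (q ≡ 2 ⊎ q ≡ 3) → ∀ B → ∃ λ (FG : Monic × Monic) → B < deg (proj₁ FG) × φ (proj₁ FG) ≡ σ (proj₂ FG)
  -- `suc B` and not `B`, so that deg P > 1 and P ≠ T when q = 3.
  pair q≡ B = choose q≡ (large-prime (suc B))
    where
    choose : (q ≡ 2 ⊎ q ≡ 3) → (∃ λ P → IsPrime P × suc B < deg P) →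
             ∃ λ (FG : Monic × Monic) → B < deg (proj₁ FG) × φ (proj₁ FG) ≡ σ (proj₂ FG)
    choose (inj₁ q≡2) (P , pp , B<P) =
      (P , T ^ᴹ (deg P ∸ 1) · one) , <⇒≤ B<P , pair₂ q≡2 P pp
    choose (inj₂ q≡3) (P , pp , B<P) =
      (T · P , T ^ᴹ (deg P ∸ 1) · (T+1 ^ᴹ 1 · one)) ,
      subst (B <_) (sym (deg-· T P)) (m≤n⇒m≤1+n (<⇒≤ B<P)) ,
      pair₃ q≡3 P pp (≤-trans (s≤s (s≤s z≤n)) B<P)

  -- The sum of the degrees of the first components bounds each of them, so a pair with deg F beyond
  -- that sum is new.
  outside-list : (q ≡ 2 ⊎ q ≡ 3) → (L : List (Monic × Monic)) →
                 ∃ λ FG → FG ∉ L × φ (proj₁ FG) ≡ σ (proj₂ FG)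
  outside-list q≡ L = let FG , large , eq = pair q≡ (sum (map (deg ∘ proj₁) L)) in
    FG , (λ FG∈L → <⇒≱ large (∈⇒≤sum (∈-map⁺ (deg ∘ proj₁) FG∈L))) , eq

only-trivial-pair : ∀ q (𝔽 : FiniteField q) → let open FF 𝔽 in
  q ≢ 2 → q ≢ 3 → (F G : Monic) → φ F ≡ σ G → F ≡ one × G ≡ one
only-trivial-pair (suc (suc (suc (suc r)))) 𝔽 _ _ = Finiteness.φ≡σ⇒one 𝔽 (s≤s (s≤s (s≤s z≤n)))
only-trivial-pair 3 _ _ q≢3 = ⊥-elim (q≢3 refl)
only-trivial-pair 2 _ q≢2 _ = ⊥-elim (q≢2 refl)
only-trivial-pair 1 𝔽 _ _ = ⊥-elim (<-irrefl refl (Arithmetic.q>1 𝔽))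
only-trivial-pair 0 𝔽 _ _ = ⊥-elim (n≮0 (Arithmetic.q>1 𝔽))

theorem1p1 : (q : ℕ) (𝔽 : FiniteField q) →
    let open FF 𝔽 in
    ((q ≡ 2 ⊎ q ≡ 3) →
    (L : List (Monic × Monic)) →
    Σ (Monic × Monic) (λ FG → FG ∉ L × φ (Data.Product.proj₁ FG) ≡ σ (Data.Product.proj₂ FG)))
    × (q ≢ 2 → q ≢ 3 → (F G : Monic) → φ F ≡ σ G → F ≡ one × G ≡ one)
theorem1p1 q 𝔽 = Infinitude.outside-list 𝔽 , only-trivial-pair q 𝔽
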